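{- Let $G$ be a connected, triangle-free graph. Then $G$ is $2$-$\gamma_{\rm MB}'$-critical if and only if $G \in \mathcal{B}$ or $G = C_5$.
   Context: All graphs are finite and simple; equality of graphs and membership in a family are meant up to isomorphism. A set $D\subseteq V(G)$ is a dominating set of $G$ if every vertex of $V(G)-D$ has a neighbor in $D$. Maker-Breaker domination game (S-game): two players, Dominator and Staller, alternately select a vertex of $G$ that has not been selected before, with Staller moving first. Dominator's goal is that at some point the set of vertices he has selected is a dominating set of $G$; Staller's goal is to prevent this. The game ends when one of the players accomplishes the goal. If Dominator wins the S-game on $G$ under optimal play, then $\gamma_{\rm MB}'(G)$ is the number of moves Dominator makes when both players play optimally (Dominator wants to minimize the number of his moves, Staller wants to maximize it); equivalently, it is the least $k$ such that Dominator has a strategy guaranteeing that he has selected a dominating set after at most $k$ of his moves. If Staller wins, $\gamma_{\rm MB}'(G)=\infty$. A graph $G$ is $2$-$\gamma_{\rm MB}'$-critical if $\gamma_{\rm MB}'(G)=2$ and $\gamma_{\rm MB}'(G-e)>2$ for every $e\in E(G)$, where $G-e$ is obtained from $G$ by deleting the edge $e$ (and $\infty>2$). Family $\mathcal{B}$: a graph $G$ belongs to $\mathcal{B}$ if either $G=K_{2,m}$ with $m\ge 3$, or $G$ is a bipartite graph with a bipartition $V(G)=V_1\cup V_2$, where $|V_1|=m\ge 3$, $|V_2|=n\ge 3$, such that $V_1$ contains exactly two vertices of degree $n$, $V_2$ contains exactly two vertices of degree $m$, and all other vertices have degree $2$. $C_5$ is the cycle on $5$ vertices. -}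

module Defs where

open import Level using (0ℓ)
open import Data.Fin using (Fin; toℕ; _≟_)
open import Data.Fin.Properties using (all?)
open import Data.Fin.Subset using (Subset; _∈_; _∉_; _∪_; _∩_; ∁; ⁅_⁆; ∣_∣) renaming (⊥ to ∅)
open import Data.Nat as ℕ using (ℕ; suc; _+_; _%_; _<_; _≤_)
import Data.Nat.Properties as ℕₚ
open import Data.Product using (∃; ∃-syntax; _×_; _,_; swap)
open import Data.Sum as Sum using (_⊎_; inj₁; inj₂; [_,_]′)
open import Data.Vec using (tabulate)
open import Function using (_∘_)
open import Function.Bundles using (_↔_; _⇔_; Inverse)
open import Relation.Binary.Core using (Rel)
open import Relation.Binary.Definitions using (Symmetric; Irreflexive; Decidable)
open import Relation.Binary.Construct.Closure.ReflexiveTransitive using (Star)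
open import Relation.Binary.PropositionalEquality using (_≡_; refl)
open import Relation.Nullary using (¬_; does)
open import Relation.Nullary.Decidable using (¬?; _×-dec_; _⊎-dec_; from-yes)

-- Finite simple graphs of order n.  Since everything below is invariant under
-- isomorphism, the vertex set is taken to be Fin n.
record Graph (n : ℕ) : Set₁ where
  infix 4 _~_ _~?_
  field
    _~_      : Rel (Fin n) 0ℓ
    _~?_     : Decidable _~_
    ~-sym    : Symmetric _~_
    ~-irrefl : Irreflexive _≡_ _~_

infix 4 _≅_
record _≅_ {m n : ℕ} (G : Graph m) (H : Graph n) : Set where
  private
    module G = Graph G
    module H = Graph H
  field
    bijection : Fin m ↔ Fin n
  open Inverse bijection public using (to; from)
  field
    preserves : ∀ u v → (u G.~ v) ⇔ (to u H.~ to v)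

module _ {n : ℕ} (G : Graph n) where
  open Graph G

  Connected : Set
  Connected = ∀ u v → Star _~_ u v

  TriangleFree : Set
  TriangleFree = ∀ u v w → u ~ v → v ~ w → ¬ (u ~ w)

  degree : Fin n → ℕ
  degree v = ∣ tabulate (λ u → does (v ~? u)) ∣

  verticesOfDegree : ℕ → Subset n
  verticesOfDegree d = tabulate (λ v → does (degree v ℕ.≟ d))

  Independent : Subset n → Set
  Independent A = ∀ {u v} → u ∈ A → v ∈ A → ¬ (u ~ v)

  -- V₁ and its complement are the two sides of a bipartition.
  IsBipartition : Subset n → Set
  IsBipartition V₁ = Independent V₁ × Independent (∁ V₁)

  Dominating : Subset n → Set
  Dominating D = ∀ v → v ∉ D → ∃[ u ] u ∈ D × v ~ u

  deleteEdge : Fin n → Fin n → Graph n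
  deleteEdge a b = record
    { _~_      = λ x y → x ~ y × ¬ IsDeleted x y
    ; _~?_     = λ x y → (x ~? y) ×-dec
                   ¬? (((x ≟ a) ×-dec (y ≟ b)) ⊎-dec ((x ≟ b) ×-dec (y ≟ a)))
    ; ~-sym    = λ (p , q) → ~-sym p , q ∘ [ inj₂ ∘ swap , inj₁ ∘ swap ]′
    ; ~-irrefl = λ eq (p , _) → ~-irrefl eq p
    }
    where
    IsDeleted : Rel (Fin n) 0ℓ
    IsDeleted x y = (x ≡ a × y ≡ b) ⊎ (x ≡ b × y ≡ a)

  -- Positions (D , S) of the game: D and S are the vertices selected so far by
  -- Dominator and by Staller.
  Free : Subset n → Subset n → Fin n → Set
  Free D S v = v ∉ D × v ∉ S

  -- Strategies of Dominator from a position with Staller to move which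
  -- guarantee that he has selected a dominating set after at most k further
  -- moves of his own.  The first component of `round` ensures that Dominator
  -- does not win vacuously when all vertices have been selected.
  data DominatorWinsWithin : ℕ → Subset n → Subset n → Set where
    done  : ∀ {k D S} → Dominating D → DominatorWinsWithin k D S
    round : ∀ {k D S} → ∃ (Free D S) →
            (∀ s → Free D S s →
              ∃[ d ] Free D (S ∪ ⁅ s ⁆) d ×
                     DominatorWinsWithin k (D ∪ ⁅ d ⁆) (S ∪ ⁅ s ⁆)) →
            DominatorWinsWithin (suc k) D S

  DominatorWinsSGame : ℕ → Set
  DominatorWinsSGame k = DominatorWinsWithin k ∅ ∅

  -- γ′MB takes values in ℕ ∪ {∞}: it is the least k with DominatorWinsSGame k,
  -- and ∞ if there is none.  It is given through its (in)equalities with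
  -- natural numbers; γ′MB> k includes the value ∞.
  γ′MB≡ : ℕ → Set
  γ′MB≡ k = DominatorWinsSGame k × (∀ j → DominatorWinsSGame j → k ≤ j)

  γ′MB> : ℕ → Set
  γ′MB> k = ∀ j → DominatorWinsSGame j → k < j

Critical : ∀ {n} → ℕ → Graph n → Set
Critical k G = γ′MB≡ G k × (∀ u v → u ~ v → γ′MB> (deleteEdge G u v) k)
  where open Graph G

-- The complete bipartite graph, with sides {0,…,p-1} and {p,…,p+q-1}.
K : (p q : ℕ) → Graph (p + q)
K p q = record
  { _~_      = λ x y → (toℕ x < p × p ≤ toℕ y) ⊎ (p ≤ toℕ x × toℕ y < p)
  ; _~?_     = λ x y → ((toℕ x ℕ.<? p) ×-dec (p ℕ.≤? toℕ y)) ⊎-dec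
                       ((p ℕ.≤? toℕ x) ×-dec (toℕ y ℕ.<? p))
  ; ~-sym    = [ inj₂ ∘ swap , inj₁ ∘ swap ]′
  ; ~-irrefl = λ { refl (inj₁ (x<p , p≤x)) → ℕₚ.<⇒≱ x<p p≤x
                 ; refl (inj₂ (p≤x , x<p)) → ℕₚ.<⇒≱ x<p p≤x }
  }

C₅ : Graph 5
C₅ = record
  { _~_      = Consecutive
  ; _~?_     = consecutive?
  ; ~-sym    = Sum.swap
  ; ~-irrefl = λ { {x} refl → from-yes (all? (λ x → ¬? (consecutive? x x))) x }
  }
  where
  Consecutive : Rel (Fin 5) 0ℓ
  Consecutive x y = (toℕ y ≡ suc (toℕ x) % 5) ⊎ (toℕ x ≡ suc (toℕ y) % 5)

  consecutive? : Decidable Consecutive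
  consecutive? x y = (toℕ y ℕ.≟ suc (toℕ x) % 5) ⊎-dec (toℕ x ℕ.≟ suc (toℕ y) % 5)

-- The bipartite graphs with sides V₁ and V₂ of sizes m, n ≥ 3 in which exactly
-- two vertices of V₁ have degree n, exactly two vertices of V₂ have degree m,
-- and all other vertices have degree 2.
record Bipartiteℬ {N : ℕ} (G : Graph N) : Set where
  field
    V₁ : Subset N

  V₂ : Subset N
  V₂ = ∁ V₁

  m : ℕ
  m = ∣ V₁ ∣

  n : ℕ
  n = ∣ V₂ ∣

  full₁ : Subset N
  full₁ = V₁ ∩ verticesOfDegree G n

  full₂ : Subset N
  full₂ = V₂ ∩ verticesOfDegree G m

  field
    bipartition : IsBipartition G V₁
    m≥3         : 3 ≤ m
    n≥3         : 3 ≤ n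
    two-full₁   : ∣ full₁ ∣ ≡ 2
    two-full₂   : ∣ full₂ ∣ ≡ 2
    others      : ∀ v → v ∉ full₁ → v ∉ full₂ → degree G v ≡ 2

ℬ : ∀ {n} → Graph n → Set
ℬ G = (∃[ m ] 3 ≤ m × G ≅ K 2 m) ⊎ Bipartiteℬ G

{-# OPTIONS --safe #-}
-- Call {x , y} dominating pairs the edges of an auxiliary graph. Dominator wins within two
-- moves exactly if for every opening move s of Staller some vertex d ≠ s lies on two such
-- pairs {d , e}, {d , f} avoiding s: a fork. For G triangle-free of minimum degree at least 2,
-- a fork is of one of three kinds. If d is adjacent to neither e nor f, then G is a blow-up
-- of C₅, and the fork answering the opening move d shows that nothing is blown up. If d is
-- adjacent to just one of them, then {d , f} is one full side of a bipartite graph. If d is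
-- adjacent to both, then e and f are full, and a second fork, answering the opening move d,
-- supplies two full vertices on the other side. A bipartite graph with two full vertices on
-- each side has enough dominating pairs from these alone, so criticality removes every edge
-- avoiding them, which leaves ℬ. Conversely, deleting an edge at a vertex of degree 2 leaves a
-- pendant vertex, which no graph with forks and at least five vertices has; deleting an edge
-- between full vertices allows Staller to leave only disjoint dominating pairs.

module Submission where

open import Defs
open import Data.Empty using (⊥; ⊥-elim)
open import Data.Fin using (Fin; zero; suc; toℕ; _≟_)
open import Data.Fin.Properties using (any?; all?)
open import Data.Fin.Subset using (Subset; inside; outside; _∈_; _∉_; _⊆_; _∪_; _∩_; _-_; ∁; ⁅_⁆; ∣_∣; ⊤) renaming (⊥ to ∅)
open import Data.Fin.Subset.Properties
open import Data.Fin.Patterns using (0F; 1F; 2F; 3F; 4F)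
open import Data.Fin.Permutation using (↔⇒≡)
open import Data.List using (List; []; _∷_; length; lookup; filter; allFin)
open import Data.List.Membership.Propositional using () renaming (_∈_ to _∈ₗ_)
open import Data.List.Membership.Propositional.Properties using (∈-lookup; ∈-filter⁺; ∈-filter⁻; ∈-allFin)
open import Data.List.Relation.Unary.All as All using (All; []; _∷_)
open import Data.List.Relation.Unary.AllPairs using ([]; _∷_)
open import Data.List.Relation.Unary.Any as Any using (here; there)
open import Data.List.Relation.Unary.Any.Properties using (lookup-index)
open import Data.List.Relation.Unary.Unique.Propositional using (Unique)
open import Data.List.Relation.Unary.Unique.Propositional.Properties using (filter⁺; allFin⁺)
open import Data.Nat as ℕ using (ℕ; zero; suc; _+_; _<_; _≤_; z≤n; s≤s)
import Data.Nat.Properties as ℕₚ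
open import Data.Product using (∃; ∃-syntax; _×_; _,_; proj₁; proj₂; swap)
open import Data.Sum using (_⊎_; inj₁; inj₂; [_,_]′)
import Data.Sum as Sum
open import Data.Vec using (tabulate; _∷_; here; there)
open import Data.Vec.Properties using (lookup∘tabulate; []=⇒lookup; lookup⇒[]=)
open import Function using (_∘_)
open import Function.Bundles using (_⇔_; mk⇔; mk↔ₛ′; Inverse; Equivalence)
open import Relation.Binary.Construct.Closure.ReflexiveTransitive using (Star; ε; _◅_)
open import Relation.Binary.PropositionalEquality using (_≡_; _≢_; refl; sym; trans; cong; subst; subst₂; ≢-sym)
open import Relation.Nullary using (¬_; Dec; yes; no; does)
open import Relation.Nullary.Decidable using (¬?; _×-dec_; _⊎-dec_; _→-dec_; dec-true; True; toWitness; from-yes; from-no)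
open import Relation.Unary using (Pred; Decidable)
open import Level using (0ℓ)

-- Subsets of Fin n and lists

x∉p-x : ∀ {n} (p : Subset n) x → x ∉ p - x
x∉p-x (inside  ∷ p) zero    ()
x∉p-x (outside ∷ p) zero    ()
x∉p-x (_       ∷ p) (suc x) (there x∈) = x∉p-x p x x∈

∣p∣≤1+∣p-x∣ : ∀ {n} (p : Subset n) x → ∣ p ∣ ≤ suc ∣ p - x ∣
∣p∣≤1+∣p-x∣ (inside  ∷ p) zero    = ℕₚ.≤-reflexive (cong (suc ∘ ∣_∣) (sym (p─⊥≡p p)))
∣p∣≤1+∣p-x∣ (outside ∷ p) zero    = ℕₚ.m≤n⇒m≤1+n (ℕₚ.≤-reflexive (cong ∣_∣ (sym (p─⊥≡p p))))
∣p∣≤1+∣p-x∣ (inside  ∷ p) (suc x) = s≤s (∣p∣≤1+∣p-x∣ p x)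
∣p∣≤1+∣p-x∣ (outside ∷ p) (suc x) = ∣p∣≤1+∣p-x∣ p x

module _ {n : ℕ} where

  -- This is the `tabulate` form of `degree` and `verticesOfDegree`, so the two membership lemmas
  -- apply directly to neighbourhoods and degree classes.
  ⟦_⟧ : {P : Pred (Fin n) 0ℓ} → Decidable P → Subset n
  ⟦ P? ⟧ = tabulate (λ v → does (P? v))

  module _ {P : Pred (Fin n) 0ℓ} (P? : Decidable P) where

    ∈⟦⟧⁺ : ∀ {v} → P v → v ∈ ⟦ P? ⟧
    ∈⟦⟧⁺ {v} pv = lookup⇒[]= v _ (trans (lookup∘tabulate _ v) (dec-true (P? v) pv))

    ∈⟦⟧⁻ : ∀ {v} → v ∈ ⟦ P? ⟧ → P v
    ∈⟦⟧⁻ {v} v∈ with P? v | trans (sym (lookup∘tabulate (λ v → does (P? v)) v)) ([]=⇒lookup v∈)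
    ... | yes pv | _ = pv

  length≤∣p∣ : ∀ {xs} {p : Subset n} → Unique xs → All (_∈ p) xs → length xs ≤ ∣ p ∣
  length≤∣p∣ [] [] = z≤n
  length≤∣p∣ {x ∷ xs} {p} (x∉xs ∷ u) (x∈p ∷ xs⊆p) =
    ℕₚ.≤-trans (s≤s (length≤∣p∣ u (All.zipWith (λ (x≢y , y∈p) → x∈p∧x≢y⇒x∈p-y y∈p (≢-sym x≢y)) (x∉xs , xs⊆p))))
               (x∈p⇒∣p-x∣<∣p∣ x∈p)

  ∣p∣≤length : ∀ xs {p : Subset n} → (∀ {v} → v ∈ p → v ∈ₗ xs) → ∣ p ∣ ≤ length xs
  ∣p∣≤length []       {p} p⊆[] =
    ℕₚ.≤-reflexive (trans (cong ∣_∣ (Empty-unique λ (_ , v∈p) → case-[] (p⊆[] v∈p))) (∣⊥∣≡0 n))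
    where
    case-[] : ∀ {v} → ¬ (v ∈ₗ [])
    case-[] ()
  ∣p∣≤length (x ∷ xs) {p} p⊆xs = ℕₚ.≤-trans (∣p∣≤1+∣p-x∣ p x) (s≤s (∣p∣≤length xs p-x⊆xs))
    where
    p-x⊆xs : ∀ {v} → v ∈ p - x → v ∈ₗ xs
    p-x⊆xs v∈ with p⊆xs (p─q⊆p p ⁅ x ⁆ v∈)
    ... | here refl  = ⊥-elim (x∉p-x p x v∈)
    ... | there v∈xs = v∈xs

  ∣p∣≡length : ∀ {xs} {p : Subset n} → Unique xs → All (_∈ p) xs →
               (∀ {v} → v ∈ p → v ∈ₗ xs) → ∣ p ∣ ≡ length xs
  ∣p∣≡length u xs⊆p p⊆xs = ℕₚ.≤-antisym (∣p∣≤length _ p⊆xs) (length≤∣p∣ u xs⊆p)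

  record Enumeration (p : Subset n) : Set where
    field
      elements : List (Fin n)
      unique   : Unique elements
      sound    : ∀ {v} → v ∈ₗ elements → v ∈ p
      complete : ∀ {v} → v ∈ p → v ∈ₗ elements

    size : length elements ≡ ∣ p ∣
    size = sym (∣p∣≡length unique (All.tabulate sound) complete)

  enumerate : ∀ p → Enumeration p
  enumerate p = record
    { elements = filter (_∈? p) (allFin n)
    ; unique   = filter⁺ (_∈? p) (allFin⁺ n)
    ; sound    = λ v∈ → proj₂ (∈-filter⁻ (_∈? p) {xs = allFin n} v∈)
    ; complete = λ v∈p → ∈-filter⁺ (_∈? p) (∈-allFin _) v∈p
    }

  record TwoElements (p : Subset n) : Set where
    field
      fst snd : Fin n
      fst≢snd : fst ≢ snd
      fst∈    : fst ∈ p
      snd∈    : snd ∈ p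
      only    : ∀ {v} → v ∈ p → v ≡ fst ⊎ v ≡ snd

  twoElements : ∀ {p} → ∣ p ∣ ≡ 2 → TwoElements p
  twoElements {p} ∣p∣≡2 with enumerate p
  ... | e with Enumeration.elements e | Enumeration.unique e | Enumeration.sound e
             | Enumeration.complete e | trans (Enumeration.size e) ∣p∣≡2
  -- The size equation in the last position makes every other length of the list absurd.
  ... | x ∷ y ∷ [] | (x≢y ∷ []) ∷ _ | sound | complete | _ = record
    { fst = x ; snd = y ; fst≢snd = x≢y ; fst∈ = sound (here refl) ; snd∈ = sound (there (here refl))
    ; only = λ v∈p → case-pair (complete v∈p) }
    where
    case-pair : ∀ {v} → v ∈ₗ x ∷ y ∷ [] → v ≡ x ⊎ v ≡ y
    case-pair (here v≡x)         = inj₁ v≡x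
    case-pair (there (here v≡y)) = inj₂ v≡y

  thirdElement : ∀ (p : Subset n) → 3 ≤ ∣ p ∣ → ∀ x y → ∃ λ z → z ∈ p × z ≢ x × z ≢ y
  thirdElement p 3≤∣p∣ x y
    with any? (λ z → (z ∈? p) ×-dec (¬? (z ≟ x) ×-dec ¬? (z ≟ y)))
  ... | yes w = w
  ... | no ¬w = ⊥-elim (ℕₚ.<⇒≱ 3≤∣p∣ (∣p∣≤length (x ∷ y ∷ []) p⊆))
    where
    p⊆ : ∀ {v} → v ∈ p → v ∈ₗ x ∷ y ∷ []
    p⊆ {v} v∈p with v ≟ x | v ≟ y
    ... | yes v≡x | _       = here v≡x
    ... | no _    | yes v≡y = there (here v≡y)
    ... | no v≢x  | no v≢y  = ⊥-elim (¬w (v , v∈p , v≢x , v≢y))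

  fourCover⇒n≤4 : ∀ {a b c d : Fin n} → (∀ v → v ≡ a ⊎ v ≡ b ⊎ v ≡ c ⊎ v ≡ d) → n ≤ 4
  fourCover⇒n≤4 {a} {b} {c} {d} cover =
    subst (_≤ 4) (∣⊤∣≡n n) (∣p∣≤length (a ∷ b ∷ c ∷ d ∷ []) {p = ⊤} λ {v} _ → mem (cover v))
    where
    mem : ∀ {v} → v ≡ a ⊎ v ≡ b ⊎ v ≡ c ⊎ v ≡ d → v ∈ₗ a ∷ b ∷ c ∷ d ∷ []
    mem (inj₁ e)               = here e
    mem (inj₂ (inj₁ e))        = there (here e)
    mem (inj₂ (inj₂ (inj₁ e))) = there (there (here e))
    mem (inj₂ (inj₂ (inj₂ e))) = there (there (there (here e)))

  ⊆∧∣∣≡⇒⊇ : ∀ {p q : Subset n} → p ⊆ q → ∣ p ∣ ≡ ∣ q ∣ → q ⊆ p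
  ⊆∧∣∣≡⇒⊇ {p} p⊆q eq {w} w∈q with w ∈? p
  ... | yes w∈p = w∈p
  ... | no w∉p  = ⊥-elim (ℕₚ.<-irrefl eq (p⊂q⇒∣p∣<∣q∣ (p⊆q , w , w∈q , w∉p)))

lookup-injective : ∀ {A : Set} {xs : List A} → Unique xs → ∀ {i j} → lookup xs i ≡ lookup xs j → i ≡ j
lookup-injective (_ ∷ _)    {zero}  {zero}  _  = refl
lookup-injective (x∉xs ∷ _) {zero}  {suc j} eq = ⊥-elim (All.lookup x∉xs (∈-lookup j) eq)
lookup-injective (x∉xs ∷ _) {suc i} {zero}  eq = ⊥-elim (All.lookup x∉xs (∈-lookup i) (sym eq))
lookup-injective (_ ∷ u)    {suc i} {suc j} eq = cong suc (lookup-injective u eq)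

both⇔ : {A B : Set} → A → B → A ⇔ B
both⇔ a b = mk⇔ (λ _ → b) (λ _ → a)

neither⇔ : {A B : Set} → ¬ A → ¬ B → A ⇔ B
neither⇔ ¬a ¬b = mk⇔ (⊥-elim ∘ ¬a) (⊥-elim ∘ ¬b)

-- Positions in the list serve as the vertices of `H`, which reduces an isomorphism to a table of
-- adjacencies.
≅-by-listing : ∀ {n} (G : Graph n) {xs : List (Fin n)} → Unique xs → (∀ v → v ∈ₗ xs) →
               (H : Graph (length xs)) →
               (∀ i j → (Graph._~_ G (lookup xs i) (lookup xs j)) ⇔ (Graph._~_ H i j)) → G ≅ H
≅-by-listing G {xs} u complete H pres = record
  { bijection = mk↔ₛ′ index (lookup xs)
      (λ i → lookup-injective u (sym (lookup-index (complete (lookup xs i)))))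
      (λ v → sym (lookup-index (complete v)))
  ; preserves = λ v w → mk⇔
      (λ e → Equivalence.to (pres _ _) (subst₂ _∼_ (at v) (at w) e))
      (λ e → subst₂ _∼_ (sym (at v)) (sym (at w)) (Equivalence.from (pres _ _) e))
  }
  where
  open Graph G using () renaming (_~_ to _∼_)
  index : _ → Fin (length xs)
  index v = Any.index (complete v)
  at : ∀ v → v ≡ lookup xs (index v)
  at v = lookup-index (complete v)

-- Dominating pairs and the game

module _ {n : ℕ} (G : Graph n) where
  open Graph G

  -- Membership of `v` in the closed neighbourhood of `x`.
  Near : Fin n → Fin n → Set
  Near x v = v ≡ x ⊎ v ~ x

  DominatingVertex : Fin n → Set
  DominatingVertex x = ∀ v → Near x v

  DominatingPair : Fin n → Fin n → Set
  DominatingPair x y = ∀ v → Near x v ⊎ Near y v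

  -- Dominator's answer centre to the move s leaves the double threat left, right.
  record Fork (s : Fin n) : Set where
    field
      centre left right : Fin n
      centre≢s     : centre ≢ s
      left≢s       : left ≢ s
      right≢s      : right ≢ s
      left≢centre  : left ≢ centre
      right≢centre : right ≢ centre
      left≢right   : left ≢ right
      dom-left     : DominatingPair centre left
      dom-right    : DominatingPair centre right

  Forked : Set
  Forked = ∀ s → Fork s

∈∪⁅⁆⁻ : ∀ {n} {p : Subset n} {x y} → y ∈ p ∪ ⁅ x ⁆ → y ∈ p ⊎ y ≡ x
∈∪⁅⁆⁻ {p = p} {x} = Sum.map₂ (x∈⁅y⁆⇒x≡y x) ∘ x∈p∪q⁻ p ⁅ x ⁆

∈∪⁅⁆⁺ : ∀ {n} {p : Subset n} {x} → x ∈ p ∪ ⁅ x ⁆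
∈∪⁅⁆⁺ {p = p} {x} = x∈p∪q⁺ {p = p} (inj₂ (x∈⁅x⁆ x))

∉∪⁅⁆⁺ : ∀ {n} {p : Subset n} {x y} → y ∉ p → y ≢ x → y ∉ p ∪ ⁅ x ⁆
∉∪⁅⁆⁺ {p = p} y∉p y≢x y∈ = [ y∉p , y≢x ]′ (∈∪⁅⁆⁻ {p = p} y∈)

∉∪⁅⁆⁻ : ∀ {n} {p : Subset n} {x y} → y ∉ p ∪ ⁅ x ⁆ → y ∉ p × y ≢ x
∉∪⁅⁆⁻ {p = p} {x} y∉ = (λ y∈p → y∉ (x∈p∪q⁺ (inj₁ y∈p))) , λ { refl → y∉ (∈∪⁅⁆⁺ {p = p}) }

module _ {n : ℕ} {G : Graph n} where
  open Graph G

  -- The sets `∅ ∪ ⁅ d ⁆` here and `(∅ ∪ ⁅ d ⁆) ∪ ⁅ e ⁆` below are Dominator's positions after one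
  -- and two moves, as the rules produce them.
  dominating⇒vertex : ∀ {d} → Dominating G (∅ ∪ ⁅ d ⁆) → DominatingVertex G d
  dominating⇒vertex {d} dom v with v ≟ d
  ... | yes v≡d = inj₁ v≡d
  ... | no v≢d with dom v (∉∪⁅⁆⁺ {p = ∅} ∉⊥ v≢d)
  ... | u , u∈ , v~u with ∈∪⁅⁆⁻ {p = ∅} u∈
  ... | inj₁ u∈∅  = ⊥-elim (∉⊥ u∈∅)
  ... | inj₂ refl = inj₂ v~u

  dominating⇒pair : ∀ {d e} → Dominating G ((∅ ∪ ⁅ d ⁆) ∪ ⁅ e ⁆) → DominatingPair G d e
  dominating⇒pair {d} {e} dom v with v ≟ d | v ≟ e
  ... | yes v≡d | _       = inj₁ (inj₁ v≡d)
  ... | no _    | yes v≡e = inj₂ (inj₁ v≡e)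
  ... | no v≢d  | no v≢e with dom v (∉∪⁅⁆⁺ {p = ∅ ∪ ⁅ d ⁆} (∉∪⁅⁆⁺ {p = ∅} ∉⊥ v≢d) v≢e)
  ... | u , u∈ , v~u with ∈∪⁅⁆⁻ {p = ∅ ∪ ⁅ d ⁆} u∈
  ... | inj₂ refl = inj₂ (inj₂ v~u)
  ... | inj₁ u∈d with ∈∪⁅⁆⁻ {p = ∅} u∈d
  ... | inj₁ u∈∅  = ⊥-elim (∉⊥ u∈∅)
  ... | inj₂ refl = inj₁ (inj₂ v~u)

  vertex⇒dominating : ∀ {d} → DominatingVertex G d → Dominating G (∅ ∪ ⁅ d ⁆)
  vertex⇒dominating {d} dom v v∉ with dom v
  ... | inj₁ v≡d = ⊥-elim (proj₂ (∉∪⁅⁆⁻ {p = ∅} v∉) v≡d)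
  ... | inj₂ v~d = d , ∈∪⁅⁆⁺ {p = ∅} , v~d

  pair⇒dominating : ∀ {d e} → DominatingPair G d e → Dominating G ((∅ ∪ ⁅ d ⁆) ∪ ⁅ e ⁆)
  pair⇒dominating {d} {e} dom v v∉ with ∉∪⁅⁆⁻ {p = ∅ ∪ ⁅ d ⁆} v∉ | dom v
  ... | v∉d , _   | inj₁ (inj₁ v≡d) = ⊥-elim (proj₂ (∉∪⁅⁆⁻ {p = ∅} v∉d) v≡d)
  ... | _         | inj₁ (inj₂ v~d) = d , x∈p∪q⁺ (inj₁ (∈∪⁅⁆⁺ {p = ∅})) , v~d
  ... | _   , v≢e | inj₂ (inj₁ v≡e) = ⊥-elim (v≢e v≡e)
  ... | _         | inj₂ (inj₂ v~e) = e , ∈∪⁅⁆⁺ {p = ∅ ∪ ⁅ d ⁆} , v~e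

  ¬dominating-∅ : Fin n → ¬ Dominating G ∅
  ¬dominating-∅ v dom = ∉⊥ (proj₁ (proj₂ (dom v ∉⊥)))

  winsWithin-mono : ∀ {j k D S} → j ≤ k → DominatorWinsWithin G j D S → DominatorWinsWithin G k D S
  winsWithin-mono _         (done dom)     = done dom
  winsWithin-mono (s≤s j≤k) (round free r) =
    round free λ s s-free → let d , d-free , w = r s s-free in d , d-free , winsWithin-mono j≤k w

  ¬wins₀ : Fin n → ¬ DominatorWinsSGame G 0
  ¬wins₀ v (done dom) = ¬dominating-∅ v dom

  wins₁⇒vertex : Fin n → DominatorWinsSGame G 1 → ∃ (DominatingVertex G)
  wins₁⇒vertex v (done dom)  = ⊥-elim (¬dominating-∅ v dom)
  wins₁⇒vertex v (round _ r) with r v (∉⊥ , ∉⊥)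
  ... | d , _ , done dom = d , dominating⇒vertex dom

  twoVertices⇒wins₁ : ∀ {a b} → a ≢ b → DominatingVertex G a → DominatingVertex G b → DominatorWinsSGame G 1
  twoVertices⇒wins₁ {a} {b} a≢b dom-a dom-b = round (a , ∉⊥ , ∉⊥) answer
    where
    answer : ∀ s → Free G ∅ ∅ s → ∃[ d ] Free G ∅ (∅ ∪ ⁅ s ⁆) d × DominatorWinsWithin G 0 (∅ ∪ ⁅ d ⁆) (∅ ∪ ⁅ s ⁆)
    answer s _ with a ≟ s
    ... | no a≢s   = a , (∉⊥ , ∉∪⁅⁆⁺ {p = ∅} ∉⊥ a≢s) , done (vertex⇒dominating dom-a)
    ... | yes refl = b , (∉⊥ , ∉∪⁅⁆⁺ {p = ∅} ∉⊥ (≢-sym a≢b)) , done (vertex⇒dominating dom-b)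

  -- After the answer `d` the strategy is consulted twice: against an arbitrary free `t` it reveals
  -- a completing vertex `e`, and against the move `e` it must reveal a different one, `f`.
  wins₂⇒answer : DominatorWinsSGame G 2 → ∀ s → (∃ λ d → d ≢ s × DominatingVertex G d) ⊎ Fork G s
  wins₂⇒answer (done dom)  s = ⊥-elim (¬dominating-∅ s dom)
  wins₂⇒answer (round _ r) s with r s (∉⊥ , ∉⊥)
  ... | d , (_ , d∉s) , done dom = inj₁ (d , proj₂ (∉∪⁅⁆⁻ {p = ∅} d∉s) , dominating⇒vertex dom)
  ... | d , (_ , d∉s) , round (t , t-free) r′ with r′ t t-free
  ... | e , (e∉d , e∉st) , done dom-e with ∉∪⁅⁆⁻ {p = ∅ ∪ ⁅ s ⁆} e∉st
  ... | e∉s , _ with r′ e (e∉d , e∉s)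
  ... | f , (f∉d , f∉se) , done dom-f with ∉∪⁅⁆⁻ {p = ∅ ∪ ⁅ s ⁆} f∉se
  ... | f∉s , f≢e = inj₂ record
    { centre = d ; left = e ; right = f
    ; centre≢s     = proj₂ (∉∪⁅⁆⁻ {p = ∅} d∉s)
    ; left≢s       = proj₂ (∉∪⁅⁆⁻ {p = ∅} e∉s)
    ; right≢s      = proj₂ (∉∪⁅⁆⁻ {p = ∅} f∉s)
    ; left≢centre  = proj₂ (∉∪⁅⁆⁻ {p = ∅} e∉d)
    ; right≢centre = proj₂ (∉∪⁅⁆⁻ {p = ∅} f∉d)
    ; left≢right   = ≢-sym f≢e
    ; dom-left     = dominating⇒pair dom-e
    ; dom-right    = dominating⇒pair dom-f
    }

  wins₂⇒forked : DominatorWinsSGame G 2 → (∀ d → ¬ DominatingVertex G d) → Forked G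
  wins₂⇒forked w ¬dom s = [ (λ (d , _ , dom) → ⊥-elim (¬dom d dom)) , (λ fork → fork) ]′ (wins₂⇒answer w s)

  forked⇒wins₂ : Fin n → Forked G → DominatorWinsSGame G 2
  forked⇒wins₂ v₀ forked = round (v₀ , ∉⊥ , ∉⊥) answer
    where
    answer : ∀ s → Free G ∅ ∅ s → ∃[ d ] Free G ∅ (∅ ∪ ⁅ s ⁆) d × DominatorWinsWithin G 1 (∅ ∪ ⁅ d ⁆) (∅ ∪ ⁅ s ⁆)
    answer s _ = d , (∉⊥ , avoid s centre≢s) , round (e , avoid d left≢centre , avoid s left≢s) answer′
      where
      open Fork (forked s) renaming (centre to d; left to e; right to f)
      avoid : ∀ x {y} → y ≢ x → y ∉ ∅ ∪ ⁅ x ⁆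
      avoid x = ∉∪⁅⁆⁺ {p = ∅} ∉⊥
      answer′ : ∀ t → Free G (∅ ∪ ⁅ d ⁆) (∅ ∪ ⁅ s ⁆) t →
                ∃[ d′ ] Free G (∅ ∪ ⁅ d ⁆) ((∅ ∪ ⁅ s ⁆) ∪ ⁅ t ⁆) d′ ×
                        DominatorWinsWithin G 0 ((∅ ∪ ⁅ d ⁆) ∪ ⁅ d′ ⁆) ((∅ ∪ ⁅ s ⁆) ∪ ⁅ t ⁆)
      answer′ t _ with e ≟ t
      ... | no e≢t   = e , (avoid d left≢centre , ∉∪⁅⁆⁺ {p = ∅ ∪ ⁅ s ⁆} (avoid s left≢s) e≢t)
                         , done (pair⇒dominating dom-left)
      ... | yes refl = f , (avoid d right≢centre , ∉∪⁅⁆⁺ {p = ∅ ∪ ⁅ s ⁆} (avoid s right≢s) (≢-sym left≢right))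
                         , done (pair⇒dominating dom-right)

-- Triangle-free graphs in which Dominator can always create a double threat

module _ {n : ℕ} (G : Graph n) where
  open Graph G

  ~⇒≢ : ∀ {u v} → u ~ v → u ≢ v
  ~⇒≢ u~v u≡v = ~-irrefl u≡v u~v

  -- The exceptional graphs of order four. Further edges are unrestricted, so the path is included,
  -- where pendant vertices do coexist with forks.
  record TwoEdges (a b c d : Fin n) : Set where
    field
      a~b   : a ~ b
      c~d   : c ~ d
      a≢c   : a ≢ c
      a≢d   : a ≢ d
      b≢c   : b ≢ c
      b≢d   : b ≢ d
      cover : ∀ v → v ≡ a ⊎ v ≡ b ⊎ v ≡ c ⊎ v ≡ d

  -- Applied to `x₁` and `x₂`, `cover` yields all four edges between the two pairs. In a
  -- triangle-free graph each pair is then full on its own side of a bipartition.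
  record Biclique (x₁ x₂ y₁ y₂ : Fin n) : Set where
    field
      x₁≢x₂ : x₁ ≢ x₂
      y₁≢y₂ : y₁ ≢ y₂
      cover : ∀ v → (v ~ x₁ × v ~ x₂) ⊎ (v ~ y₁ × v ~ y₂)

  -- Stated without counting: no single vertex `w`, adjacent to `v` or not, exhausts the
  -- neighbourhood of `v`.
  MinDegree≥2 : Set
  MinDegree≥2 = ∀ v w → v ≢ w → ∃ λ z → v ~ z × z ≢ w

module _ {n : ℕ} {G : Graph n} where
  open Graph G

  dominatingPair-sym : ∀ {x y} → DominatingPair G x y → DominatingPair G y x
  dominatingPair-sym dom v = Sum.swap (dom v)

  -- The four pairs of an `x` and a `y` all dominate and form a 4-cycle in the auxiliary graph;
  -- whichever vertex Staller takes, a path of two pairs survives.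
  doublePair⇒forked : ∀ {x₁ x₂ y₁ y₂} → x₁ ≢ x₂ → y₁ ≢ y₂ →
    x₁ ≢ y₁ → x₁ ≢ y₂ → x₂ ≢ y₁ → x₂ ≢ y₂ →
    (∀ v → (Near G x₁ v × Near G x₂ v) ⊎ (Near G y₁ v × Near G y₂ v)) → Forked G
  doublePair⇒forked {x₁} {x₂} {y₁} {y₂} x₁≢x₂ y₁≢y₂ x₁≢y₁ x₁≢y₂ x₂≢y₁ x₂≢y₂ cover s
    with s ≟ x₁ | s ≟ y₁ | s ≟ y₂
  ... | yes refl | _ | _ = record
    { centre = x₂ ; left = y₁ ; right = y₂
    ; centre≢s = ≢-sym x₁≢x₂ ; left≢s = ≢-sym x₁≢y₁ ; right≢s = ≢-sym x₁≢y₂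
    ; left≢centre = ≢-sym x₂≢y₁ ; right≢centre = ≢-sym x₂≢y₂ ; left≢right = y₁≢y₂
    ; dom-left = Sum.map proj₂ proj₁ ∘ cover ; dom-right = Sum.map proj₂ proj₂ ∘ cover }
  ... | no _ | yes refl | _ = record
    { centre = y₂ ; left = x₁ ; right = x₂
    ; centre≢s = ≢-sym y₁≢y₂ ; left≢s = x₁≢y₁ ; right≢s = x₂≢y₁
    ; left≢centre = x₁≢y₂ ; right≢centre = x₂≢y₂ ; left≢right = x₁≢x₂
    ; dom-left = Sum.swap ∘ Sum.map proj₁ proj₂ ∘ cover ; dom-right = Sum.swap ∘ Sum.map proj₂ proj₂ ∘ cover }
  ... | no _ | no _ | yes refl = record
    { centre = y₁ ; left = x₁ ; right = x₂
    ; centre≢s = y₁≢y₂ ; left≢s = x₁≢y₂ ; right≢s = x₂≢y₂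
    ; left≢centre = x₁≢y₁ ; right≢centre = x₂≢y₁ ; left≢right = x₁≢x₂
    ; dom-left = Sum.swap ∘ Sum.map proj₁ proj₁ ∘ cover ; dom-right = Sum.swap ∘ Sum.map proj₂ proj₁ ∘ cover }
  -- This includes the case `s ≡ x₂`, as that vertex is not in the fork.
  ... | no s≢x₁ | no s≢y₁ | no s≢y₂ = record
    { centre = x₁ ; left = y₁ ; right = y₂
    ; centre≢s = ≢-sym s≢x₁ ; left≢s = ≢-sym s≢y₁ ; right≢s = ≢-sym s≢y₂
    ; left≢centre = ≢-sym x₁≢y₁ ; right≢centre = ≢-sym x₁≢y₂ ; left≢right = y₁≢y₂
    ; dom-left = Sum.map proj₁ proj₁ ∘ cover ; dom-right = Sum.map proj₁ proj₂ ∘ cover }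

  -- One end from each of the two edges suffices to dominate.
  twoEdges⇒forked : ∀ {a b c d} → TwoEdges G a b c d → Forked G
  twoEdges⇒forked {a} {b} {c} {d} te =
    doublePair⇒forked (~⇒≢ G a~b) (~⇒≢ G c~d) a≢c a≢d b≢c b≢d near
    where
    open TwoEdges te
    near : ∀ v → (Near G a v × Near G b v) ⊎ (Near G c v × Near G d v)
    near v with cover v
    ... | inj₁ refl               = inj₁ (inj₁ refl , inj₂ a~b)
    ... | inj₂ (inj₁ refl)        = inj₁ (inj₂ (~-sym a~b) , inj₁ refl)
    ... | inj₂ (inj₂ (inj₁ refl)) = inj₂ (inj₁ refl , inj₂ c~d)
    ... | inj₂ (inj₂ (inj₂ refl)) = inj₂ (inj₂ (~-sym c~d) , inj₁ refl)

  biclique-swap : ∀ {x₁ x₂ y₁ y₂} → Biclique G x₁ x₂ y₁ y₂ → Biclique G y₁ y₂ x₁ x₂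
  biclique-swap bc = record { x₁≢x₂ = y₁≢y₂ ; y₁≢y₂ = x₁≢x₂ ; cover = Sum.swap ∘ cover }
    where open Biclique bc

  biclique-swapˡ : ∀ {x₁ x₂ y₁ y₂} → Biclique G x₁ x₂ y₁ y₂ → Biclique G x₂ x₁ y₁ y₂
  biclique-swapˡ bc = record { x₁≢x₂ = ≢-sym x₁≢x₂ ; y₁≢y₂ = y₁≢y₂ ; cover = Sum.map₁ swap ∘ cover }
    where open Biclique bc

  biclique-swapʳ : ∀ {x₁ x₂ y₁ y₂} → Biclique G x₁ x₂ y₁ y₂ → Biclique G x₁ x₂ y₂ y₁
  biclique-swapʳ = biclique-swap ∘ biclique-swapˡ ∘ biclique-swap

  module BicliqueEdges {x₁ x₂ y₁ y₂} (bc : Biclique G x₁ x₂ y₁ y₂) where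
    open Biclique bc

    -- The first alternative of `cover` at `x₁` itself would be a loop.
    x₁~y : x₁ ~ y₁ × x₁ ~ y₂
    x₁~y = [ (λ (x₁~x₁ , _) → ⊥-elim (~-irrefl refl x₁~x₁)) , (λ p → p) ]′ (cover x₁)

    x₂~y : x₂ ~ y₁ × x₂ ~ y₂
    x₂~y = [ (λ (_ , x₂~x₂) → ⊥-elim (~-irrefl refl x₂~x₂)) , (λ p → p) ]′ (cover x₂)

    biclique⇒forked : Forked G
    biclique⇒forked = doublePair⇒forked x₁≢x₂ y₁≢y₂
      (~⇒≢ G (proj₁ x₁~y)) (~⇒≢ G (proj₂ x₁~y)) (~⇒≢ G (proj₁ x₂~y)) (~⇒≢ G (proj₂ x₂~y))
      (Sum.map (λ (p , q) → inj₂ p , inj₂ q) (λ (p , q) → inj₂ p , inj₂ q) ∘ cover)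

  open BicliqueEdges using (biclique⇒forked) public

module _ {n : ℕ} {G : Graph n} (tf : TriangleFree G) where
  open Graph G

  triangle : ∀ {A : Set} {u v w} → u ~ v → v ~ w → u ~ w → A
  triangle u~v v~w u~w = ⊥-elim (tf _ _ _ u~v v~w u~w)

  -- If Staller opens with w, every dominating pair left has to contain v.
  pendant⇒twoEdges : Forked G → ∀ {v w} → v ≢ w → (∀ {z} → v ~ z → z ≡ w) →
                     ∃ λ e → ∃ λ f → TwoEdges G v w e f
  pendant⇒twoEdges forked {v} {w} v≢w only-w with forked w
  ... | record { centre = d ; left = e ; right = f ; centre≢s = d≢w ; left≢s = e≢w ; right≢s = f≢w
               ; left≢centre = e≢d ; right≢centre = f≢d ; left≢right = e≢f
               ; dom-left = de ; dom-right = df } with contains-v de d≢w e≢w | contains-v df d≢w f≢w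
    where
    contains-v : ∀ {p q} → DominatingPair G p q → p ≢ w → q ≢ w → v ≡ p ⊎ v ≡ q
    contains-v dom p≢w q≢w with dom v
    ... | inj₁ (inj₁ v≡p) = inj₁ v≡p
    ... | inj₁ (inj₂ v~p) = ⊥-elim (p≢w (only-w v~p))
    ... | inj₂ (inj₁ v≡q) = inj₂ v≡q
    ... | inj₂ (inj₂ v~q) = ⊥-elim (q≢w (only-w v~q))
  -- The vertex `v` lies on both pairs, which share only the centre.
  ... | inj₂ refl | inj₁ refl = ⊥-elim (e≢d refl)
  ... | inj₂ refl | inj₂ refl = ⊥-elim (e≢f refl)
  ... | inj₁ refl | _ = e , f , record
    { a~b = v~w ; c~d = e~f ; a≢c = ≢-sym e≢d ; a≢d = ≢-sym f≢d ; b≢c = ≢-sym e≢w ; b≢d = ≢-sym f≢w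
    ; cover = cover }
    where
    -- Since `v` can dominate at most itself and `w`, all other vertices are left to its partner.
    near : ∀ {p} → DominatingPair G v p → ∀ {z} → z ≢ v → z ≢ w → Near G p z
    near dom {z} z≢v z≢w with dom z
    ... | inj₁ (inj₁ z≡v) = ⊥-elim (z≢v z≡v)
    ... | inj₁ (inj₂ z~v) = ⊥-elim (z≢w (only-w (~-sym z~v)))
    ... | inj₂ z-near     = z-near
    e~f : e ~ f
    e~f = [ (λ e≡f → ⊥-elim (e≢f e≡f)) , (λ h → h) ]′ (near df e≢d e≢w)
    v~w : v ~ w
    v~w with de w | df w
    ... | inj₁ (inj₁ w≡v) | _               = ⊥-elim (v≢w (sym w≡v))
    ... | inj₁ (inj₂ w~v) | _               = ~-sym w~v
    ... | inj₂ _          | inj₁ (inj₁ w≡v) = ⊥-elim (v≢w (sym w≡v))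
    ... | inj₂ _          | inj₁ (inj₂ w~v) = ~-sym w~v
    ... | inj₂ (inj₁ w≡e) | inj₂ _          = ⊥-elim (e≢w (sym w≡e))
    ... | inj₂ (inj₂ _)   | inj₂ (inj₁ w≡f) = ⊥-elim (f≢w (sym w≡f))
    -- If `v` did not dominate `w`, both `e` and `f` would, closing a triangle.
    ... | inj₂ (inj₂ w~e) | inj₂ (inj₂ w~f) = triangle w~e e~f w~f
    cover : ∀ z → z ≡ v ⊎ z ≡ w ⊎ z ≡ e ⊎ z ≡ f
    cover z with z ≟ v | z ≟ w
    ... | yes z≡v | _       = inj₁ z≡v
    ... | no _    | yes z≡w = inj₂ (inj₁ z≡w)
    ... | no z≢v  | no z≢w with near de z≢v z≢w | near df z≢v z≢w
    ... | inj₁ z≡e | _        = inj₂ (inj₂ (inj₁ z≡e))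
    ... | inj₂ _   | inj₁ z≡f = inj₂ (inj₂ (inj₂ z≡f))
    ... | inj₂ z~e | inj₂ z~f = triangle z~e e~f z~f

  pendant⇒¬forked : 5 ≤ n → ∀ {v w} → v ≢ w → (∀ {z} → v ~ z → z ≡ w) → ¬ Forked G
  pendant⇒¬forked 5≤n v≢w only-w forked =
    ℕₚ.<⇒≱ 5≤n (fourCover⇒n≤4 (TwoEdges.cover (proj₂ (proj₂ (pendant⇒twoEdges forked v≢w only-w)))))

  -- Forks whose centre is adjacent to neither partner

  module _ {d e f : Fin n} (e≢d : e ≢ d) (f≢d : f ≢ d) (d≁e : ¬ d ~ e) (d≁f : ¬ d ~ f)
           (e~f : e ~ f) (cover : ∀ v → v ≡ d ⊎ v ~ d ⊎ v ≡ e ⊎ v ≡ f) where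

    -- If a and z were distinct common neighbours of d and e, then {e , b} would be
    -- the only dominating pair surviving Staller's opening move d.
    commonNeighbour-unique : Fork G d → ∀ {a b z} → a ~ d → a ~ e → b ~ d → b ~ f → z ~ d → z ~ e → z ≡ a
    commonNeighbour-unique fork {a} {b} {z} a~d a~e b~d b~f z~d z~e with z ≟ a
    ... | yes z≡a = z≡a
    ... | no z≢a = ⊥-elim (no-fork (pairs centre≢s left≢s dom-left) (pairs centre≢s right≢s dom-right))
      where
      open Fork fork
      e≁d : ¬ e ~ d
      e≁d = d≁e ∘ ~-sym
      -- A neighbour `p` of `c` that is adjacent to `d` or equal to `f` closes a triangle; only `e`
      -- remains.
      near-common : ∀ {c p} → c ~ d → c ~ e → p ≢ d → Near G p c → p ≡ c ⊎ p ≡ e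
      near-common c~d c~e p≢d (inj₁ c≡p) = inj₁ (sym c≡p)
      near-common {p = p} c~d c~e p≢d (inj₂ c~p) with cover p
      ... | inj₁ p≡d                = ⊥-elim (p≢d p≡d)
      ... | inj₂ (inj₁ p~d)         = triangle c~p p~d c~d
      ... | inj₂ (inj₂ (inj₁ p≡e))  = inj₂ p≡e
      ... | inj₂ (inj₂ (inj₂ refl)) = triangle c~e e~f c~p
      -- The vertex `e` dominates neither `d` nor `b`, and a common neighbour of these two adjacent
      -- vertices would close a triangle, so the partner is `b` itself.
      partner-of-e : ∀ {q} → q ≢ d → DominatingPair G e q → q ≡ b
      partner-of-e q≢d dom with dom d | dom b
      ... | inj₁ (inj₁ d≡e) | _               = ⊥-elim (e≢d (sym d≡e))
      ... | inj₁ (inj₂ d~e) | _               = ⊥-elim (d≁e d~e)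
      ... | inj₂ (inj₁ d≡q) | _               = ⊥-elim (q≢d (sym d≡q))
      ... | inj₂ (inj₂ _)   | inj₁ (inj₁ refl) = ⊥-elim (e≁d b~d)
      ... | inj₂ (inj₂ _)   | inj₁ (inj₂ b~e) = triangle b~e e~f b~f
      ... | inj₂ (inj₂ _)   | inj₂ (inj₁ b≡q) = sym b≡q
      ... | inj₂ (inj₂ d~q) | inj₂ (inj₂ b~q) = triangle b~d d~q b~q
      not-az : ¬ DominatingPair G a z
      not-az dom with dom f
      ... | inj₁ (inj₁ refl) = d≁f (~-sym a~d)
      ... | inj₁ (inj₂ f~a)  = triangle (~-sym f~a) (~-sym e~f) a~e
      ... | inj₂ (inj₁ refl) = d≁f (~-sym z~d)
      ... | inj₂ (inj₂ f~z)  = triangle (~-sym f~z) (~-sym e~f) z~e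
      -- To dominate both `a` and `z` without `e`, the pair must be `{a , z}`, which misses `f`.
      pairs : ∀ {p q} → p ≢ d → q ≢ d → DominatingPair G p q → (p ≡ e × q ≡ b) ⊎ (p ≡ b × q ≡ e)
      pairs p≢d q≢d dom
        with Sum.map (near-common a~d a~e p≢d) (near-common a~d a~e q≢d) (dom a)
           | Sum.map (near-common z~d z~e p≢d) (near-common z~d z~e q≢d) (dom z)
      ... | inj₁ (inj₂ refl) | _                = inj₁ (refl , partner-of-e q≢d dom)
      ... | inj₂ (inj₂ refl) | _                = inj₂ (partner-of-e p≢d (dominatingPair-sym {G = G} dom) , refl)
      ... | _                | inj₁ (inj₂ refl) = inj₁ (refl , partner-of-e q≢d dom)
      ... | _                | inj₂ (inj₂ refl) = inj₂ (partner-of-e p≢d (dominatingPair-sym {G = G} dom) , refl)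
      ... | inj₁ (inj₁ refl) | inj₁ (inj₁ refl) = ⊥-elim (z≢a refl)
      ... | inj₂ (inj₁ refl) | inj₂ (inj₁ refl) = ⊥-elim (z≢a refl)
      ... | inj₁ (inj₁ refl) | inj₂ (inj₁ refl) = ⊥-elim (not-az dom)
      ... | inj₂ (inj₁ refl) | inj₁ (inj₁ refl) = ⊥-elim (not-az (dominatingPair-sym {G = G} dom))
      no-fork : (centre ≡ e × left ≡ b) ⊎ (centre ≡ b × left ≡ e) →
                (centre ≡ e × right ≡ b) ⊎ (centre ≡ b × right ≡ e) → ⊥
      no-fork (inj₁ (_ , l)) (inj₁ (_ , r)) = left≢right (trans l (sym r))
      no-fork (inj₁ (c , l)) (inj₂ (_ , r)) = right≢centre (trans r (sym c))
      no-fork (inj₂ (c , l)) (inj₁ (c′ , r)) = left≢centre (trans l (sym c′))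
      no-fork (inj₂ (_ , l)) (inj₂ (_ , r)) = left≢right (trans l (sym r))

  -- Two of the five chords are excluded by hypothesis; the other three would close triangles.
  fiveCycle : ∀ {a b d e f} → d ~ a → a ~ e → e ~ f → f ~ b → b ~ d →
              ¬ d ~ e → ¬ d ~ f → e ≢ d → f ≢ d →
              (∀ v → v ≡ d ⊎ v ≡ a ⊎ v ≡ e ⊎ v ≡ f ⊎ v ≡ b) → G ≅ C₅
  fiveCycle {a} {b} {d} {e} {f} d~a a~e e~f f~b b~d d≁e d≁f e≢d f≢d cover =
    ≅-by-listing G {d ∷ a ∷ e ∷ f ∷ b ∷ []}
      ( (~⇒≢ G d~a ∷ ≢-sym e≢d ∷ ≢-sym f≢d ∷ ≢-sym (~⇒≢ G b~d) ∷ [])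
      ∷ (~⇒≢ G a~e ∷ a≢f ∷ a≢b ∷ []) ∷ (~⇒≢ G e~f ∷ e≢b ∷ []) ∷ (~⇒≢ G f~b ∷ []) ∷ [] ∷ [])
      (λ v → mem (cover v)) C₅ adjacent
    where
    a≁f : ¬ a ~ f
    a≁f a~f = tf _ _ _ a~e e~f a~f
    a≁b : ¬ a ~ b
    a≁b a~b = tf _ _ _ d~a a~b (~-sym b~d)
    e≁b : ¬ e ~ b
    e≁b e~b = tf _ _ _ e~f f~b e~b
    a≢f : a ≢ f
    a≢f refl = d≁f d~a
    a≢b : a ≢ b
    a≢b refl = a≁f (~-sym f~b)
    e≢b : e ≢ b
    e≢b refl = d≁e (~-sym b~d)
    mem : ∀ {v} → v ≡ d ⊎ v ≡ a ⊎ v ≡ e ⊎ v ≡ f ⊎ v ≡ b → v ∈ₗ d ∷ a ∷ e ∷ f ∷ b ∷ []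
    mem (inj₁ p)                      = here p
    mem (inj₂ (inj₁ p))               = there (here p)
    mem (inj₂ (inj₂ (inj₁ p)))        = there (there (here p))
    mem (inj₂ (inj₂ (inj₂ (inj₁ p)))) = there (there (there (here p)))
    mem (inj₂ (inj₂ (inj₂ (inj₂ p)))) = there (there (there (there (here p))))
    _~₅_ = Graph._~_ C₅
    _~₅?_ = Graph._~?_ C₅
    adjacent : ∀ i j → (lookup (d ∷ a ∷ e ∷ f ∷ b ∷ []) i ~ lookup (d ∷ a ∷ e ∷ f ∷ b ∷ []) j) ⇔ (i ~₅ j)
    adjacent 0F 0F = neither⇔ (~-irrefl refl) (from-no (0F ~₅? 0F))
    adjacent 0F 1F = both⇔ d~a (from-yes (0F ~₅? 1F))
    adjacent 0F 2F = neither⇔ d≁e (from-no (0F ~₅? 2F))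
    adjacent 0F 3F = neither⇔ d≁f (from-no (0F ~₅? 3F))
    adjacent 0F 4F = both⇔ (~-sym b~d) (from-yes (0F ~₅? 4F))
    adjacent 1F 0F = both⇔ (~-sym d~a) (from-yes (1F ~₅? 0F))
    adjacent 1F 1F = neither⇔ (~-irrefl refl) (from-no (1F ~₅? 1F))
    adjacent 1F 2F = both⇔ a~e (from-yes (1F ~₅? 2F))
    adjacent 1F 3F = neither⇔ a≁f (from-no (1F ~₅? 3F))
    adjacent 1F 4F = neither⇔ a≁b (from-no (1F ~₅? 4F))
    adjacent 2F 0F = neither⇔ (d≁e ∘ ~-sym) (from-no (2F ~₅? 0F))
    adjacent 2F 1F = both⇔ (~-sym a~e) (from-yes (2F ~₅? 1F))
    adjacent 2F 2F = neither⇔ (~-irrefl refl) (from-no (2F ~₅? 2F))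
    adjacent 2F 3F = both⇔ e~f (from-yes (2F ~₅? 3F))
    adjacent 2F 4F = neither⇔ e≁b (from-no (2F ~₅? 4F))
    adjacent 3F 0F = neither⇔ (d≁f ∘ ~-sym) (from-no (3F ~₅? 0F))
    adjacent 3F 1F = neither⇔ (a≁f ∘ ~-sym) (from-no (3F ~₅? 1F))
    adjacent 3F 2F = both⇔ (~-sym e~f) (from-yes (3F ~₅? 2F))
    adjacent 3F 3F = neither⇔ (~-irrefl refl) (from-no (3F ~₅? 3F))
    adjacent 3F 4F = both⇔ f~b (from-yes (3F ~₅? 4F))
    adjacent 4F 0F = both⇔ b~d (from-yes (4F ~₅? 0F))
    adjacent 4F 1F = neither⇔ (a≁b ∘ ~-sym) (from-no (4F ~₅? 1F))
    adjacent 4F 2F = neither⇔ (e≁b ∘ ~-sym) (from-no (4F ~₅? 2F))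
    adjacent 4F 3F = both⇔ (~-sym f~b) (from-yes (4F ~₅? 3F))
    adjacent 4F 4F = neither⇔ (~-irrefl refl) (from-no (4F ~₅? 4F))

  -- Here the fork forces G to be a blow-up of C₅ along d, N(d) ∩ N(e), e, f, N(d) ∩ N(f).
  nonAdjacentFork⇒C₅ : Forked G → MinDegree≥2 G → ∀ {s} (fork : Fork G s) → let open Fork fork in
                       ¬ centre ~ left → ¬ centre ~ right → G ≅ C₅
  nonAdjacentFork⇒C₅ forked deg≥2 fork d≁e d≁f with deg≥2 left right left≢right | deg≥2 right left (≢-sym left≢right)
    where open Fork fork
  ... | a , e~a , a≢f | b , f~b , b≢e =
    fiveCycle (~-sym a~d) (~-sym e~a) e~f f~b b~d d≁e d≁f left≢centre right≢centre cover₅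
    where
    open Fork fork renaming (centre to d; left to e; right to f)
    notNear-d : ∀ {v w} → v ≢ d → ¬ v ~ d → Near G d v ⊎ Near G w v → Near G w v
    notNear-d v≢d v≁d (inj₁ (inj₁ v≡d)) = ⊥-elim (v≢d v≡d)
    notNear-d v≢d v≁d (inj₁ (inj₂ v~d)) = ⊥-elim (v≁d v~d)
    notNear-d v≢d v≁d (inj₂ h)          = h
    e~f : e ~ f
    -- Not being dominated by `d`, the vertex `e` falls to `f` in the pair `{d , f}`.
    e~f = [ (λ e≡f → ⊥-elim (left≢right e≡f)) , (λ h → h) ]′
            (notNear-d left≢centre (d≁e ∘ ~-sym) (dom-right e))
    cover : ∀ v → v ≡ d ⊎ v ~ d ⊎ v ≡ e ⊎ v ≡ f
    cover v with v ≟ d | v ~? d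
    ... | yes v≡d | _       = inj₁ v≡d
    ... | no _    | yes v~d = inj₂ (inj₁ v~d)
    ... | no v≢d  | no v≁d with notNear-d v≢d v≁d (dom-left v) | notNear-d v≢d v≁d (dom-right v)
    ... | inj₁ v≡e | _        = inj₂ (inj₂ (inj₁ v≡e))
    ... | inj₂ _   | inj₁ v≡f = inj₂ (inj₂ (inj₂ v≡f))
    ... | inj₂ v~e | inj₂ v~f = triangle v~e e~f v~f
    a~d : a ~ d
    a~d with cover a
    ... | inj₁ refl               = ⊥-elim (d≁e (~-sym e~a))
    ... | inj₂ (inj₁ h)           = h
    ... | inj₂ (inj₂ (inj₁ refl)) = ⊥-elim (~-irrefl refl e~a)
    ... | inj₂ (inj₂ (inj₂ a≡f))  = ⊥-elim (a≢f a≡f)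
    b~d : b ~ d
    b~d with cover b
    ... | inj₁ refl               = ⊥-elim (d≁f (~-sym f~b))
    ... | inj₂ (inj₁ h)           = h
    ... | inj₂ (inj₂ (inj₁ b≡e))  = ⊥-elim (b≢e b≡e)
    ... | inj₂ (inj₂ (inj₂ refl)) = ⊥-elim (~-irrefl refl f~b)
    cover′ : ∀ v → v ≡ d ⊎ v ~ d ⊎ v ≡ f ⊎ v ≡ e
    cover′ = Sum.map₂ (Sum.map₂ Sum.swap) ∘ cover
    cover₅ : ∀ v → v ≡ d ⊎ v ≡ a ⊎ v ≡ e ⊎ v ≡ f ⊎ v ≡ b
    cover₅ v with cover v
    ... | inj₁ v≡d               = inj₁ v≡d
    ... | inj₂ (inj₂ (inj₁ v≡e)) = inj₂ (inj₂ (inj₁ v≡e))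
    ... | inj₂ (inj₂ (inj₂ v≡f)) = inj₂ (inj₂ (inj₂ (inj₁ v≡f)))
    -- A second neighbour of `v` can only be `e` or `f`, and uniqueness of the common neighbour then
    -- identifies `v` with `a` or `b`.
    ... | inj₂ (inj₁ v~d) with deg≥2 v d (~⇒≢ G v~d)
    ... | w , v~w , w≢d with cover w
    ... | inj₁ w≡d        = ⊥-elim (w≢d w≡d)
    ... | inj₂ (inj₁ w~d) = triangle v~w w~d v~d
    ... | inj₂ (inj₂ (inj₁ refl)) = inj₂ (inj₁
      (commonNeighbour-unique left≢centre right≢centre d≁e d≁f e~f cover
        (forked d) a~d (~-sym e~a) b~d (~-sym f~b) v~d v~w))
    ... | inj₂ (inj₂ (inj₂ refl)) = inj₂ (inj₂ (inj₂ (inj₂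
      (commonNeighbour-unique right≢centre left≢centre d≁f d≁e (~-sym e~f) cover′
        (forked d) b~d (~-sym f~b) a~d (~-sym e~a) v~d v~w))))

  -- Forks with an adjacent partner

  HasBiclique : Set
  HasBiclique = ∃ λ x₁ → ∃ λ x₂ → ∃ λ y₁ → ∃ λ y₂ → Biclique G x₁ x₂ y₁ y₂

  -- Adjacent vertices dominate each other, so open neighbourhoods suffice; as there are no
  -- triangles, these are the sides of a bipartition.
  edgePair-cover : ∀ {p q} → p ~ q → DominatingPair G p q → ∀ v → v ~ p ⊎ v ~ q
  edgePair-cover p~q dom v with dom v
  ... | inj₁ (inj₁ refl) = inj₂ p~q
  ... | inj₁ (inj₂ v~p)  = inj₁ v~p
  ... | inj₂ (inj₁ refl) = inj₁ (~-sym p~q)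
  ... | inj₂ (inj₂ v~q)  = inj₂ v~q

  -- The side of d consists of d and f only.
  halfAdjacentFork⇒biclique : MinDegree≥2 G → ∀ {d e f} → f ≢ d → e ≢ f →
    DominatingPair G d e → DominatingPair G d f → d ~ e → ¬ d ~ f → HasBiclique
  halfAdjacentFork⇒biclique deg≥2 {d} {e} {f} f≢d e≢f de df d~e d≁f with deg≥2 f e (≢-sym e≢f)
  -- Besides `e`, the vertex `f` has a second neighbour `z`, which becomes the other full vertex on
  -- the side of `e`.
  ... | z , f~z , z≢e = e , z , d , f , record { x₁≢x₂ = ≢-sym z≢e ; y₁≢y₂ = ≢-sym f≢d ; cover = cover }
    where
    side : ∀ v → v ~ d ⊎ v ~ e
    side = edgePair-cover d~e de
    f~e : f ~ e
    f~e = [ (λ f~d → ⊥-elim (d≁f (~-sym f~d))) , (λ h → h) ]′ (side f)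
    d~z : d ~ z
    d~z = [ ~-sym , (λ z~e → triangle f~z z~e f~e) ]′ (side z)
    side-of-d : ∀ {v} → v ~ e → v ≡ d ⊎ v ≡ f
    side-of-d {v} v~e with df v
    ... | inj₁ (inj₁ v≡d) = inj₁ v≡d
    ... | inj₁ (inj₂ v~d) = triangle v~d d~e v~e
    ... | inj₂ (inj₁ v≡f) = inj₂ v≡f
    ... | inj₂ (inj₂ v~f) = triangle v~f f~e v~e
    cover : ∀ v → (v ~ e × v ~ z) ⊎ (v ~ d × v ~ f)
    cover v with side v
    cover v | inj₂ v~e with side-of-d v~e
    ... | inj₁ refl = inj₁ (d~e , d~z)
    ... | inj₂ refl = inj₁ (f~e , f~z)
    -- A second neighbour of `v` is adjacent to `e`, hence is `d` or `f`, and so it is `f`.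
    cover v | inj₁ v~d with deg≥2 v d (~⇒≢ G v~d)
    ... | w , v~w , w≢d with side w
    ... | inj₁ w~d = triangle v~w w~d v~d
    ... | inj₂ w~e with side-of-d w~e
    ... | inj₁ w≡d  = ⊥-elim (w≢d w≡d)
    ... | inj₂ refl = inj₂ (v~d , v~w)

  fork-cases : Forked G → MinDegree≥2 G → ∀ {s} (fork : Fork G s) → let open Fork fork in
               (centre ~ left × centre ~ right) ⊎ (HasBiclique ⊎ G ≅ C₅)
  fork-cases forked deg≥2 fork with Fork.centre fork ~? Fork.left fork | Fork.centre fork ~? Fork.right fork
  ... | yes d~e | yes d~f = inj₁ (d~e , d~f)
  ... | yes d~e | no d≁f  = inj₂ (inj₁ (halfAdjacentFork⇒biclique deg≥2 right≢centre left≢right dom-left dom-right d~e d≁f))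
    where open Fork fork
  ... | no d≁e  | yes d~f = inj₂ (inj₁ (halfAdjacentFork⇒biclique deg≥2 left≢centre (≢-sym left≢right) dom-right dom-left d~f d≁e))
    where open Fork fork
  ... | no d≁e  | no d≁f  = inj₂ (inj₂ (nonAdjacentFork⇒C₅ forked deg≥2 fork d≁e d≁f))

  -- G is bipartite with sides N(d) ∋ e, f and N(e) = N(f) ∋ d; the second fork
  -- supplies the missing full vertex or vertices in N(e).
  twoAdjacentForks⇒biclique : ∀ {s} (fork : Fork G s) (fork′ : Fork G (Fork.centre fork)) →
    let open Fork in
    centre fork  ~ left fork  → centre fork  ~ right fork →
    centre fork′ ~ left fork′ → centre fork′ ~ right fork′ → HasBiclique
  twoAdjacentForks⇒biclique fork fork′ d~e d~f d′~e′ d′~f′ = by-side (side-e d′)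
    where
    open Fork fork renaming (centre to d; left to e; right to f)
    open Fork fork′ using ()
      renaming (centre to d′; left to e′; right to f′; centre≢s to d′≢d; left≢right to e′≢f′
               ; dom-left to dom-left′; dom-right to dom-right′)
    side-e : ∀ v → v ~ d ⊎ v ~ e
    side-e = edgePair-cover d~e dom-left
    side-f : ∀ v → v ~ d ⊎ v ~ f
    side-f = edgePair-cover d~f dom-right
    e⇒f : ∀ {v} → v ~ e → v ~ f
    e⇒f {v} v~e = [ (λ v~d → triangle v~d d~e v~e) , (λ h → h) ]′ (side-f v)
    by-side : d′ ~ d ⊎ d′ ~ e → HasBiclique
    -- Here `d′` is on the side of `e` and `f`, so `e′` and `f′` are on the side of `d` and are full
    -- there.
    by-side (inj₁ d′~d) = e , f , e′ , f′ , record { x₁≢x₂ = left≢right ; y₁≢y₂ = e′≢f′ ; cover = cover }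
      where
      full : ∀ {v p} → v ~ d → v ~ d′ ⊎ v ~ p → v ~ p
      full v~d (inj₁ v~d′) = triangle v~d′ d′~d v~d
      full v~d (inj₂ v~p)  = v~p
      cover : ∀ v → (v ~ e × v ~ f) ⊎ (v ~ e′ × v ~ f′)
      cover v with side-e v
      ... | inj₂ v~e = inj₁ (v~e , e⇒f v~e)
      ... | inj₁ v~d = inj₂ ( full v~d (edgePair-cover d′~e′ dom-left′ v)
                            , full v~d (edgePair-cover d′~f′ dom-right′ v))
    -- Here both centres are on the same side, and they are its full vertices.
    by-side (inj₂ d′~e) = e , f , d , d′ , record { x₁≢x₂ = left≢right ; y₁≢y₂ = ≢-sym d′≢d ; cover = cover }
      where
      e′~d : e′ ~ d
      e′~d = [ (λ h → h) , (λ e′~e → triangle d′~e′ e′~e d′~e) ]′ (side-e e′)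
      cover : ∀ v → (v ~ e × v ~ f) ⊎ (v ~ d × v ~ d′)
      cover v with side-e v | edgePair-cover d′~e′ dom-left′ v
      ... | inj₂ v~e | _          = inj₁ (v~e , e⇒f v~e)
      ... | inj₁ v~d | inj₁ v~d′ = inj₂ (v~d , v~d′)
      ... | inj₁ v~d | inj₂ v~e′ = triangle v~e′ e′~d v~d

  biclique-or-C₅ : Forked G → MinDegree≥2 G → Fin n → HasBiclique ⊎ G ≅ C₅
  biclique-or-C₅ forked deg≥2 s with fork-cases forked deg≥2 (forked s)
  ... | inj₂ found = found
  ... | inj₁ (d~e , d~f) with fork-cases forked deg≥2 (forked (Fork.centre (forked s)))
  ... | inj₂ found = found
  ... | inj₁ (d′~e′ , d′~f′) = inj₁ (twoAdjacentForks⇒biclique (forked s) (forked (Fork.centre (forked s))) d~e d~f d′~e′ d′~f′)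

-- Critical graphs

module _ {n : ℕ} {G : Graph n} where
  open Graph G

  deleteEdge-keeps : ∀ {a b u v} → u ~ v → (u ≡ a → v ≢ b) → (u ≡ b → v ≢ a) →
                     Graph._~_ (deleteEdge G a b) u v
  deleteEdge-keeps u~v ¬ab ¬ba = u~v , λ { (inj₁ (p , q)) → ¬ab p q ; (inj₂ (p , q)) → ¬ba p q }

  critical⇒vertex : Critical 2 G → Fin n
  critical⇒vertex = vertex n G
    where
    vertex : ∀ n (G : Graph n) → Critical 2 G → Fin n
    -- The empty set dominates the graph without vertices, so its value is 0.
    vertex zero    G ((_ , least) , _) = ⊥-elim (ℕₚ.n≮0 (least 0 (done λ ())))
    vertex (suc n) G _                 = zero

  critical⇒¬forked : Critical 2 G → ∀ {u v} → u ~ v → ¬ Forked (deleteEdge G u v)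
  critical⇒¬forked (_ , deletion) {u} {v} u~v forked =
    ℕₚ.<-irrefl refl (deletion u v u~v 2 (forked⇒wins₂ u forked))

  -- Let Staller open with `p`. A second dominating vertex would let Dominator win in one move; a
  -- fork would consist of three neighbours of `p`, which are pairwise non-adjacent, so two of them
  -- cannot dominate the third.
  critical⇒¬dominatingVertex : TriangleFree G → Critical 2 G → ∀ p → ¬ DominatingVertex G p
  critical⇒¬dominatingVertex tf ((wins , least) , _) p dom-p with wins₂⇒answer wins p
  ... | inj₁ (d , d≢p , dom-d) = ℕₚ.<-irrefl refl (least 1 (twoVertices⇒wins₁ d≢p dom-d dom-p))
  ... | inj₂ fork with dom-p left | dom-p right | dom-left right
    where open Fork fork
  ... | inj₁ e≡p | _        | _               = Fork.left≢s fork e≡p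
  ... | inj₂ _   | inj₁ f≡p | _               = Fork.right≢s fork f≡p
  ... | inj₂ _   | inj₂ _   | inj₁ (inj₁ f≡d) = Fork.right≢centre fork f≡d
  ... | inj₂ _   | inj₂ _   | inj₂ (inj₁ f≡e) = Fork.left≢right fork (sym f≡e)
  ... | inj₂ e~p | inj₂ f~p | inj₂ (inj₂ f~e) = tf _ _ _ f~e e~p f~p
  ... | inj₂ _   | inj₂ f~p | inj₁ (inj₂ f~d) with dom-p (Fork.centre fork)
  ... | inj₁ d≡p = Fork.centre≢s fork d≡p
  ... | inj₂ d~p = tf _ _ _ f~d d~p f~p

  critical⇒forked : TriangleFree G → Critical 2 G → Forked G
  critical⇒forked tf crit@((wins , _) , _) = wins₂⇒forked wins (critical⇒¬dominatingVertex tf crit)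

  leavingEdge : ∀ {P : Fin n → Set} → (∀ v → Dec (P v)) → ∀ {u v} → Star _~_ u v → P u → ¬ P v →
                ∃ λ p → ∃ λ q → p ~ q × P p × ¬ P q
  leavingEdge P? ε         Pu ¬Pv = ⊥-elim (¬Pv Pu)
  leavingEdge P? (_◅_ {j = w} u~w w⋆v) Pu ¬Pv with P? w
  ... | yes Pw = leavingEdge P? w⋆v Pw ¬Pv
  ... | no ¬Pw = _ , w , u~w , Pu , ¬Pw

  -- Connectedness gives an edge between the two given ones, and it is redundant.
  critical⇒¬twoEdges : Connected G → Critical 2 G → ∀ {a b c d} → ¬ TwoEdges G a b c d
  critical⇒¬twoEdges conn crit {a} {b} {c} {d} te
    with leavingEdge (λ v → (v ≟ a) ⊎-dec (v ≟ b)) (conn a c) (inj₁ refl)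
                     [ ≢-sym (TwoEdges.a≢c te) , ≢-sym (TwoEdges.b≢c te) ]′
  ... | p , q , p~q , p∈ , q∉ = critical⇒¬forked crit p~q (twoEdges⇒forked record
    { a~b = deleteEdge-keeps a~b (λ _ b≡q → q∉ (inj₂ (sym b≡q))) (λ a≡q _ → q∉ (inj₁ (sym a≡q)))
    ; c~d = deleteEdge-keeps c~d (λ c≡p _ → [ (λ p≡a → a≢c (sym (trans c≡p p≡a)))
                                            , (λ p≡b → b≢c (sym (trans c≡p p≡b))) ]′ p∈)
                                 (λ _ d≡p → [ (λ p≡a → a≢d (sym (trans d≡p p≡a)))
                                            , (λ p≡b → b≢d (sym (trans d≡p p≡b))) ]′ p∈)
    ; a≢c = a≢c ; a≢d = a≢d ; b≢c = b≢c ; b≢d = b≢d ; cover = cover })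
    where open TwoEdges te

  critical⇒minDegree≥2 : Connected G → TriangleFree G → Critical 2 G → MinDegree≥2 G
  critical⇒minDegree≥2 conn tf crit v w v≢w with any? (λ z → (v ~? z) ×-dec ¬? (z ≟ w))
  ... | yes found = found
  ... | no none = ⊥-elim (critical⇒¬twoEdges conn crit (proj₂ (proj₂
                    (pendant⇒twoEdges tf (critical⇒forked tf crit) v≢w only-w))))
    where
    only-w : ∀ {z} → v ~ z → z ≡ w
    only-w {z} v~z with z ≟ w
    ... | yes z≡w = z≡w
    ... | no z≢w  = ⊥-elim (none (z , v~z , z≢w))

-- Bicliques and the family ℬ

module _ {n : ℕ} {G : Graph n} (tf : TriangleFree G) where
  open Graph G

  -- The sides of the bipartition are the neighbourhoods of `x₁` and `y₁`: `cover` makes them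
  -- exhaust the graph, and the edge between `x₁` and `y₁` makes them disjoint.
  module BicliqueSides {x₁ x₂ y₁ y₂} (bc : Biclique G x₁ x₂ y₁ y₂) where
    open Biclique bc public
    open BicliqueEdges bc using (x₁~y; x₂~y) public

    ~x₁⇒≁y₁ : ∀ {v} → v ~ x₁ → ¬ v ~ y₁
    ~x₁⇒≁y₁ v~x₁ = tf _ _ _ v~x₁ (proj₁ x₁~y)

    ~x₁⇒~x₂ : ∀ {v} → v ~ x₁ → v ~ x₂
    ~x₁⇒~x₂ {v} v~x₁ = [ proj₂ , (λ (v~y₁ , _) → ⊥-elim (~x₁⇒≁y₁ v~x₁ v~y₁)) ]′ (cover v)

    ~y₁⇒~y₂ : ∀ {v} → v ~ y₁ → v ~ y₂
    ~y₁⇒~y₂ {v} v~y₁ = [ (λ (v~x₁ , _) → ⊥-elim (~x₁⇒≁y₁ v~x₁ v~y₁)) , proj₂ ]′ (cover v)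

    ≁y₁⇒~x₁ : ∀ {v} → ¬ v ~ y₁ → v ~ x₁
    ≁y₁⇒~x₁ {v} v≁y₁ = [ proj₁ , (λ (v~y₁ , _) → ⊥-elim (v≁y₁ v~y₁)) ]′ (cover v)

  -- The listing starts with `x₁` and `x₂` and continues with the neighbours of `x₁`, of which `z`
  -- is a third.
  bicliqueWithSmallSide⇒K₂ : ∀ {x₁ x₂ y₁ y₂ z} → Biclique G x₁ x₂ y₁ y₂ →
    (∀ {v} → v ~ y₁ → v ≡ x₁ ⊎ v ≡ x₂) → z ~ x₁ → z ≢ y₁ → z ≢ y₂ → ∃[ m ] 3 ≤ m × G ≅ K 2 m
  bicliqueWithSmallSide⇒K₂ {x₁} {x₂} {y₁} {y₂} {z} bc small z~x₁ z≢y₁ z≢y₂ =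
    length ys , 3≤ , ≅-by-listing G {x₁ ∷ x₂ ∷ ys} unique complete (K 2 (length ys)) adjacent
    where
    open BicliqueSides bc
    Y = ⟦ (_~? x₁) ⟧
    open Enumeration (enumerate Y) renaming (elements to ys; unique to ys-unique; complete to ys-complete)
    ys-sound : ∀ {v} → v ∈ₗ ys → v ~ x₁
    ys-sound v∈ = ∈⟦⟧⁻ (_~? x₁) (sound v∈)
    ys~ : ∀ i → lookup ys i ~ x₁
    ys~ i = ys-sound (∈-lookup i)
    3≤ : 3 ≤ length ys
    3≤ = subst (3 ≤_) (sym size) (length≤∣p∣ {xs = y₁ ∷ y₂ ∷ z ∷ []}
      ((y₁≢y₂ ∷ ≢-sym z≢y₁ ∷ []) ∷ (≢-sym z≢y₂ ∷ []) ∷ [] ∷ [])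
      (∈⟦⟧⁺ (_~? x₁) (~-sym (proj₁ x₁~y)) ∷ ∈⟦⟧⁺ (_~? x₁) (~-sym (proj₂ x₁~y)) ∷ ∈⟦⟧⁺ (_~? x₁) z~x₁ ∷ []))
    x₂≁x₁ : ¬ x₂ ~ x₁
    x₂≁x₁ x₂~x₁ = ~x₁⇒≁y₁ x₂~x₁ (proj₁ x₂~y)
    unique : Unique (x₁ ∷ x₂ ∷ ys)
    unique = (x₁≢x₂ ∷ All.tabulate (λ { v∈ refl → ~-irrefl refl (ys-sound v∈) }))
           ∷ All.tabulate (λ { v∈ refl → x₂≁x₁ (ys-sound v∈) }) ∷ ys-unique
    complete : ∀ v → v ∈ₗ x₁ ∷ x₂ ∷ ys
    complete v with v ~? y₁
    ... | no v≁y₁ = there (there (ys-complete (∈⟦⟧⁺ (_~? x₁) (≁y₁⇒~x₁ v≁y₁))))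
    ... | yes v~y₁ with small v~y₁
    ... | inj₁ v≡x₁ = here v≡x₁
    ... | inj₂ v≡x₂ = there (here v≡x₂)
    2≤ : ∀ {k} → 2 ≤ suc (suc k)
    2≤ = s≤s (s≤s z≤n)
    adjacent : ∀ i j → (lookup (x₁ ∷ x₂ ∷ ys) i ~ lookup (x₁ ∷ x₂ ∷ ys) j) ⇔ (Graph._~_ (K 2 (length ys)) i j)
    adjacent zero zero = neither⇔ (~-irrefl refl) λ { (inj₁ (_ , ())) ; (inj₂ (() , _)) }
    adjacent zero (suc zero) = neither⇔ (x₂≁x₁ ∘ ~-sym) λ { (inj₁ (_ , s≤s ())) ; (inj₂ (() , _)) }
    adjacent zero (suc (suc j)) = both⇔ (~-sym (ys~ j)) (inj₁ (s≤s z≤n , 2≤))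
    adjacent (suc zero) zero = neither⇔ x₂≁x₁ λ { (inj₁ (_ , ())) ; (inj₂ (s≤s () , _)) }
    adjacent (suc zero) (suc zero) = neither⇔ (~-irrefl refl) λ { (inj₁ (_ , s≤s ())) ; (inj₂ (s≤s () , _)) }
    adjacent (suc zero) (suc (suc j)) = both⇔ (~-sym (~x₁⇒~x₂ (ys~ j))) (inj₁ (s≤s (s≤s z≤n) , 2≤))
    adjacent (suc (suc i)) zero = both⇔ (ys~ i) (inj₂ (2≤ , s≤s z≤n))
    adjacent (suc (suc i)) (suc zero) = both⇔ (~x₁⇒~x₂ (ys~ i)) (inj₂ (2≤ , s≤s (s≤s z≤n)))
    adjacent (suc (suc i)) (suc (suc j)) =
      neither⇔ (λ h → tf _ _ _ h (ys~ j) (ys~ i)) λ { (inj₁ (s≤s (s≤s ()) , _)) ; (inj₂ (_ , s≤s (s≤s ()))) }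

  module _ {x₁ x₂ y₁ y₂} (bc : Biclique G x₁ x₂ y₁ y₂) where
    open BicliqueSides bc
    open BicliqueSides (biclique-swap bc) using () renaming (≁y₁⇒~x₁ to ≁x₁⇒~y₁)

    -- Every edge required by the biclique has a full end, so an edge with no full end could be
    -- deleted without destroying the forks.
    critical⇒nonFullIndependent : Critical 2 G → ∀ {x y} → x ~ y₁ → x ≢ x₁ → x ≢ x₂ →
                                  y ~ x₁ → y ≢ y₁ → y ≢ y₂ → ¬ x ~ y
    critical⇒nonFullIndependent crit {x} {y} x~y₁ x≢x₁ x≢x₂ y~x₁ y≢y₁ y≢y₂ x~y =
      critical⇒¬forked crit x~y (biclique⇒forked record { x₁≢x₂ = x₁≢x₂ ; y₁≢y₂ = y₁≢y₂ ; cover = cover′ })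
      where
      _~′_ = Graph._~_ (deleteEdge G x y)
      -- The full end `p` differs from `x` by assumption and from `y` because `y` is on the other
      -- side.
      keep-x : ∀ {t p} → t ~ p → p ≢ x → p ~ y₁ → t ~′ p
      keep-x t~p p≢x p~y₁ = deleteEdge-keeps {G = G} t~p (λ { _ refl → ~x₁⇒≁y₁ y~x₁ p~y₁ }) (λ _ p≡x → p≢x p≡x)
      keep-y : ∀ {t p} → t ~ p → p ≢ y → p ~ x₁ → t ~′ p
      keep-y t~p p≢y p~x₁ = deleteEdge-keeps {G = G} t~p (λ _ p≡y → p≢y p≡y) (λ { _ refl → ~x₁⇒≁y₁ p~x₁ x~y₁ })
      cover′ : ∀ t → (t ~′ x₁ × t ~′ x₂) ⊎ (t ~′ y₁ × t ~′ y₂)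
      cover′ t with cover t
      ... | inj₁ (t~x₁ , t~x₂) = inj₁ ( keep-x t~x₁ (≢-sym x≢x₁) (proj₁ x₁~y)
                                      , keep-x t~x₂ (≢-sym x≢x₂) (proj₁ x₂~y))
      ... | inj₂ (t~y₁ , t~y₂) = inj₂ ( keep-y t~y₁ (≢-sym y≢y₁) (~-sym (proj₁ x₁~y))
                                      , keep-y t~y₂ (≢-sym y≢y₂) (~-sym (proj₂ x₁~y)))

    -- The vertices `u` and `v` bring both sides to size three. A non-full vertex is adjacent to the
    -- two full vertices opposite and, by `critical⇒nonFullIndependent`, to nothing else.
    critical⇒bipartiteℬ : ∀ {u v} → u ~ y₁ → u ≢ x₁ → u ≢ x₂ → v ~ x₁ → v ≢ y₁ → v ≢ y₂ →
                          Critical 2 G → Bipartiteℬ G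
    critical⇒bipartiteℬ {u} {v} u~y₁ u≢x₁ u≢x₂ v~x₁ v≢y₁ v≢y₂ crit = record
      { V₁          = V₁
      ; bipartition = (λ p∈ q∈ p~q → tf _ _ _ p~q (V₁⁻ q∈) (V₁⁻ p∈))
                    , (λ p∈ q∈ p~q → tf _ _ _ p~q (V₂⁻ q∈) (V₂⁻ p∈))
      ; m≥3         = m≥3
      ; n≥3         = n≥3
      ; two-full₁   = ∣p∣≡length ((x₁≢x₂ ∷ []) ∷ [] ∷ []) (full₁⁺ x₁∈V₁ x₁-full ∷ full₁⁺ x₂∈V₁ x₂-full ∷ [])
                        (λ t∈ → full₁⁻ (V₁⁻ (p∩q⊆p _ _ t∈)) (∈⟦⟧⁻ (hasDegree ∣ V₂ ∣) (p∩q⊆q _ _ t∈)))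
      ; two-full₂   = ∣p∣≡length ((y₁≢y₂ ∷ []) ∷ [] ∷ []) (full₂⁺ y₁∈V₂ y₁-full ∷ full₂⁺ y₂∈V₂ y₂-full ∷ [])
                        (λ t∈ → full₂⁻ (V₂⁻ (p∩q⊆p _ _ t∈)) (∈⟦⟧⁻ (hasDegree ∣ V₁ ∣) (p∩q⊆q _ _ t∈)))
      ; others      = others
      }
      where
      V₁ V₂ : Subset n
      V₁ = ⟦ (_~? y₁) ⟧
      V₂ = ∁ V₁
      V₁⁺ : ∀ {t} → t ~ y₁ → t ∈ V₁
      V₁⁺ = ∈⟦⟧⁺ (_~? y₁)
      V₁⁻ : ∀ {t} → t ∈ V₁ → t ~ y₁
      V₁⁻ = ∈⟦⟧⁻ (_~? y₁)
      V₂⁺ : ∀ {t} → t ~ x₁ → t ∈ V₂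
      V₂⁺ t~x₁ = x∉p⇒x∈∁p (~x₁⇒≁y₁ t~x₁ ∘ V₁⁻)
      V₂⁻ : ∀ {t} → t ∈ V₂ → t ~ x₁
      V₂⁻ t∈ = ≁y₁⇒~x₁ (x∈∁p⇒x∉p t∈ ∘ V₁⁺)
      x₁∈V₁ : x₁ ∈ V₁
      x₁∈V₁ = V₁⁺ (proj₁ x₁~y)
      x₂∈V₁ : x₂ ∈ V₁
      x₂∈V₁ = V₁⁺ (proj₁ x₂~y)
      y₁∈V₂ : y₁ ∈ V₂
      y₁∈V₂ = V₂⁺ (~-sym (proj₁ x₁~y))
      y₂∈V₂ : y₂ ∈ V₂
      y₂∈V₂ = V₂⁺ (~-sym (proj₂ x₁~y))
      m≥3 : 3 ≤ ∣ V₁ ∣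
      m≥3 = length≤∣p∣ {xs = x₁ ∷ x₂ ∷ u ∷ []} ((x₁≢x₂ ∷ ≢-sym u≢x₁ ∷ []) ∷ (≢-sym u≢x₂ ∷ []) ∷ [] ∷ [])
              (x₁∈V₁ ∷ x₂∈V₁ ∷ V₁⁺ u~y₁ ∷ [])
      n≥3 : 3 ≤ ∣ V₂ ∣
      n≥3 = length≤∣p∣ {xs = y₁ ∷ y₂ ∷ v ∷ []} ((y₁≢y₂ ∷ ≢-sym v≢y₁ ∷ []) ∷ (≢-sym v≢y₂ ∷ []) ∷ [] ∷ [])
              (y₁∈V₂ ∷ y₂∈V₂ ∷ V₂⁺ v~x₁ ∷ [])
      hasDegree : ∀ d t → Dec (degree G t ≡ d)
      hasDegree d t = degree G t ℕ.≟ d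
      nbrs-of-V₁ : ∀ {t w} → t ~ y₁ → t ~ w → w ~ x₁
      nbrs-of-V₁ t~y₁ t~w = ≁y₁⇒~x₁ (λ w~y₁ → tf _ _ _ t~w w~y₁ t~y₁)
      nbrs-of-V₂ : ∀ {t w} → t ~ x₁ → t ~ w → w ~ y₁
      nbrs-of-V₂ t~x₁ t~w = ≁x₁⇒~y₁ (λ w~x₁ → tf _ _ _ t~w w~x₁ t~x₁)
      full-degree₁ : ∀ {x} → x ~ y₁ → (∀ {w} → w ~ x₁ → w ~ x) → degree G x ≡ ∣ V₂ ∣
      full-degree₁ {x} x~y₁ full = cong ∣_∣ (⊆-antisym
        (λ w∈ → V₂⁺ (nbrs-of-V₁ x~y₁ (∈⟦⟧⁻ (x ~?_) w∈)))
        (λ w∈ → ∈⟦⟧⁺ (x ~?_) (~-sym (full (V₂⁻ w∈)))))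
      full-degree₂ : ∀ {y} → y ~ x₁ → (∀ {w} → w ~ y₁ → w ~ y) → degree G y ≡ ∣ V₁ ∣
      full-degree₂ {y} y~x₁ full = cong ∣_∣ (⊆-antisym
        (λ w∈ → V₁⁺ (nbrs-of-V₂ y~x₁ (∈⟦⟧⁻ (y ~?_) w∈)))
        (λ w∈ → ∈⟦⟧⁺ (y ~?_) (~-sym (full (V₁⁻ w∈)))))
      x₁-full : degree G x₁ ≡ ∣ V₂ ∣
      x₁-full = full-degree₁ (proj₁ x₁~y) (λ h → h)
      x₂-full : degree G x₂ ≡ ∣ V₂ ∣
      x₂-full = full-degree₁ (proj₁ x₂~y) ~x₁⇒~x₂
      y₁-full : degree G y₁ ≡ ∣ V₁ ∣
      y₁-full = full-degree₂ (~-sym (proj₁ x₁~y)) (λ h → h)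
      y₂-full : degree G y₂ ≡ ∣ V₁ ∣
      y₂-full = full-degree₂ (~-sym (proj₂ x₁~y)) ~y₁⇒~y₂
      degree≡2 : ∀ {t p q} → p ≢ q → t ~ p → t ~ q → (∀ {w} → t ~ w → w ≢ p → w ≢ q → ⊥) → degree G t ≡ 2
      degree≡2 {t} {p} {q} p≢q t~p t~q none = ∣p∣≡length ((p≢q ∷ []) ∷ [] ∷ [])
        (∈⟦⟧⁺ (t ~?_) t~p ∷ ∈⟦⟧⁺ (t ~?_) t~q ∷ []) only
        where
        only : ∀ {w} → w ∈ ⟦ (t ~?_) ⟧ → w ∈ₗ p ∷ q ∷ []
        only {w} w∈ with w ≟ p | w ≟ q
        ... | yes w≡p | _       = here w≡p
        ... | no _    | yes w≡q = there (here w≡q)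
        ... | no w≢p  | no w≢q  = ⊥-elim (none (∈⟦⟧⁻ (t ~?_) w∈) w≢p w≢q)
      degree₁ : ∀ {t} → t ~ y₁ → t ≢ x₁ → t ≢ x₂ → degree G t ≡ 2
      degree₁ t~y₁ t≢x₁ t≢x₂ = degree≡2 y₁≢y₂ t~y₁ (~y₁⇒~y₂ t~y₁) λ t~w w≢y₁ w≢y₂ →
        critical⇒nonFullIndependent crit t~y₁ t≢x₁ t≢x₂ (nbrs-of-V₁ t~y₁ t~w) w≢y₁ w≢y₂ t~w
      degree₂ : ∀ {t} → t ~ x₁ → t ≢ y₁ → t ≢ y₂ → degree G t ≡ 2
      degree₂ t~x₁ t≢y₁ t≢y₂ = degree≡2 x₁≢x₂ t~x₁ (~x₁⇒~x₂ t~x₁) λ t~w w≢x₁ w≢x₂ →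
        critical⇒nonFullIndependent crit (nbrs-of-V₂ t~x₁ t~w) w≢x₁ w≢x₂ t~x₁ t≢y₁ t≢y₂ (~-sym t~w)
      full₁⁺ : ∀ {t} → t ∈ V₁ → degree G t ≡ ∣ V₂ ∣ → t ∈ V₁ ∩ verticesOfDegree G ∣ V₂ ∣
      full₁⁺ t∈ eq = x∈p∩q⁺ (t∈ , ∈⟦⟧⁺ (hasDegree ∣ V₂ ∣) eq)
      full₂⁺ : ∀ {t} → t ∈ V₂ → degree G t ≡ ∣ V₁ ∣ → t ∈ V₂ ∩ verticesOfDegree G ∣ V₁ ∣
      full₂⁺ t∈ eq = x∈p∩q⁺ (t∈ , ∈⟦⟧⁺ (hasDegree ∣ V₁ ∣) eq)
      full₁⁻ : ∀ {t} → t ~ y₁ → degree G t ≡ ∣ V₂ ∣ → t ∈ₗ x₁ ∷ x₂ ∷ []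
      full₁⁻ {t} t~y₁ eq with t ≟ x₁ | t ≟ x₂
      ... | yes t≡x₁ | _        = here t≡x₁
      ... | no _     | yes t≡x₂ = there (here t≡x₂)
      -- A non-full vertex has degree 2, less than the size of the opposite side.
      ... | no t≢x₁  | no t≢x₂  = ⊥-elim (ℕₚ.<-irrefl (trans (sym (degree₁ t~y₁ t≢x₁ t≢x₂)) eq) n≥3)
      full₂⁻ : ∀ {t} → t ~ x₁ → degree G t ≡ ∣ V₁ ∣ → t ∈ₗ y₁ ∷ y₂ ∷ []
      full₂⁻ {t} t~x₁ eq with t ≟ y₁ | t ≟ y₂
      ... | yes t≡y₁ | _        = here t≡y₁
      ... | no _     | yes t≡y₂ = there (here t≡y₂)
      ... | no t≢y₁  | no t≢y₂  = ⊥-elim (ℕₚ.<-irrefl (trans (sym (degree₂ t~x₁ t≢y₁ t≢y₂)) eq) m≥3)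
      others : ∀ t → t ∉ V₁ ∩ verticesOfDegree G ∣ V₂ ∣ → t ∉ V₂ ∩ verticesOfDegree G ∣ V₁ ∣ → degree G t ≡ 2
      others t t∉₁ t∉₂ with t ~? y₁
      ... | yes t~y₁ = degree₁ t~y₁ (λ { refl → t∉₁ (full₁⁺ x₁∈V₁ x₁-full) })
                                    (λ { refl → t∉₁ (full₁⁺ x₂∈V₁ x₂-full) })
      ... | no t≁y₁  = degree₂ (≁y₁⇒~x₁ t≁y₁) (λ { refl → t∉₂ (full₂⁺ y₁∈V₂ y₁-full) })
                                              (λ { refl → t∉₂ (full₂⁺ y₂∈V₂ y₂-full) })

  -- A third vertex on both sides gives `Bipartiteℬ`, on just one side `K 2 m`; with none the graph
  -- is a 4-cycle, which `critical⇒¬twoEdges` excludes.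
  biclique⇒ℬ : Connected G → Critical 2 G → ∀ {x₁ x₂ y₁ y₂} → Biclique G x₁ x₂ y₁ y₂ → ℬ G
  biclique⇒ℬ conn crit {x₁} {x₂} {y₁} {y₂} bc = by-sides (exhausted? y₁ x₁ x₂) (exhausted? x₁ y₁ y₂)
    where
    open BicliqueSides bc
    exhausted? : ∀ w p q → (∃ λ t → t ~ w × t ≢ p × t ≢ q) ⊎ (∀ {t} → t ~ w → t ≡ p ⊎ t ≡ q)
    exhausted? w p q with any? (λ t → (t ~? w) ×-dec (¬? (t ≟ p) ×-dec ¬? (t ≟ q)))
    ... | yes found = inj₁ found
    ... | no none = inj₂ only
      where
      only : ∀ {t} → t ~ w → t ≡ p ⊎ t ≡ q
      only {t} t~w with t ≟ p | t ≟ q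
      ... | yes t≡p | _       = inj₁ t≡p
      ... | no _    | yes t≡q = inj₂ t≡q
      ... | no t≢p  | no t≢q  = ⊥-elim (none (t , t~w , t≢p , t≢q))
    by-sides : (∃ λ t → t ~ y₁ × t ≢ x₁ × t ≢ x₂) ⊎ (∀ {t} → t ~ y₁ → t ≡ x₁ ⊎ t ≡ x₂) →
               (∃ λ t → t ~ x₁ × t ≢ y₁ × t ≢ y₂) ⊎ (∀ {t} → t ~ x₁ → t ≡ y₁ ⊎ t ≡ y₂) → ℬ G
    by-sides (inj₁ (_ , u~y₁ , u≢x₁ , u≢x₂)) (inj₁ (_ , v~x₁ , v≢y₁ , v≢y₂)) =
      inj₂ (critical⇒bipartiteℬ bc u~y₁ u≢x₁ u≢x₂ v~x₁ v≢y₁ v≢y₂ crit)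
    by-sides (inj₁ (_ , u~y₁ , u≢x₁ , u≢x₂)) (inj₂ smallY) =
      inj₁ (bicliqueWithSmallSide⇒K₂ (biclique-swap bc) smallY u~y₁ u≢x₁ u≢x₂)
    by-sides (inj₂ smallX) (inj₁ (_ , v~x₁ , v≢y₁ , v≢y₂)) =
      inj₁ (bicliqueWithSmallSide⇒K₂ bc smallX v~x₁ v≢y₁ v≢y₂)
    by-sides (inj₂ smallX) (inj₂ smallY) = ⊥-elim (critical⇒¬twoEdges conn crit record
      { a~b = proj₁ x₁~y ; c~d = proj₂ x₂~y
      ; a≢c = x₁≢x₂ ; a≢d = ~⇒≢ G (proj₂ x₁~y) ; b≢c = ≢-sym (~⇒≢ G (proj₁ x₂~y)) ; b≢d = y₁≢y₂
      ; cover = cover₄ })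
      where
      cover₄ : ∀ t → t ≡ x₁ ⊎ t ≡ y₁ ⊎ t ≡ x₂ ⊎ t ≡ y₂
      cover₄ t with cover t
      ... | inj₁ (t~x₁ , _) = [ inj₂ ∘ inj₁ , inj₂ ∘ inj₂ ∘ inj₂ ]′ (smallY t~x₁)
      ... | inj₂ (t~y₁ , _) = [ inj₁ , inj₂ ∘ inj₂ ∘ inj₁ ]′ (smallX t~y₁)

  critical⇒ℬ-or-C₅ : Connected G → Critical 2 G → ℬ G ⊎ G ≅ C₅
  critical⇒ℬ-or-C₅ conn crit =
    Sum.map₁ (λ (_ , _ , _ , _ , bc) → biclique⇒ℬ conn crit bc)
      (biclique-or-C₅ tf (critical⇒forked tf crit) (critical⇒minDegree≥2 conn tf crit) (critical⇒vertex crit))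

-- Essential edges

module _ {n : ℕ} (G : Graph n) where
  open Graph G

  -- Quantifying over all spanning subgraphs without the edge, rather than naming `deleteEdge`,
  -- makes the notion visibly symmetric in `a` and `b`.
  Essential : Fin n → Fin n → Set₁
  Essential a b = (H : Graph n) → (∀ {s t} → Graph._~_ H s t → s ~ t) →
                  ¬ Graph._~_ H a b → ¬ Forked H

  -- The inequalities with `v` are what the pendant-vertex lemma asks for; `p` and `q` may coincide.
  AtMostTwoNeighbours : Fin n → Set
  AtMostTwoNeighbours v = ∃ λ p → ∃ λ q → v ≢ p × v ≢ q × (∀ t → v ~ t → t ≡ p ⊎ t ≡ q)

module _ {n : ℕ} {G : Graph n} where
  open Graph G

  essential-sym : ∀ {a b} → Essential G a b → Essential G b a
  essential-sym ess H H⊆G b≁a = ess H H⊆G (b≁a ∘ Graph.~-sym H)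

  -- A dominating vertex after a deletion would already dominate `G`, so a win within two moves on
  -- the smaller graph could only come from forks.
  essential⇒critical : Fin n → Forked G → (∀ p → ¬ DominatingVertex G p) →
                       (∀ {a b} → a ~ b → Essential G a b) → Critical 2 G
  essential⇒critical v₀ forked ¬dom ess = (forked⇒wins₂ v₀ forked , least) , deletion
    where
    least : ∀ j → DominatorWinsSGame G j → 2 ≤ j
    least 0             wins = ⊥-elim (¬wins₀ v₀ wins)
    least 1             wins = let p , dom = wins₁⇒vertex v₀ wins in ⊥-elim (¬dom p dom)
    least (suc (suc _)) _    = s≤s (s≤s z≤n)
    deletion : ∀ a b → a ~ b → γ′MB> (deleteEdge G a b) 2
    deletion a b a~b j wins with j ℕ.≤? 2
    ... | no j≰2  = ℕₚ.≰⇒> j≰2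
    ... | yes j≤2 = ⊥-elim (ess a~b (deleteEdge G a b) proj₁ (λ (_ , kept) → kept (inj₁ (refl , refl)))
          (wins₂⇒forked (winsWithin-mono j≤2 wins) λ p dom → ¬dom p (Sum.map₂ proj₁ ∘ dom)))

  module _ (tf : TriangleFree G) where

    -- The two full vertices on the side of `p` are not adjacent to `p`, so both would have to equal
    -- it.
    biclique⇒¬dominatingVertex : ∀ {x₁ x₂ y₁ y₂} → Biclique G x₁ x₂ y₁ y₂ → ∀ p → ¬ DominatingVertex G p
    biclique⇒¬dominatingVertex {x₁} {x₂} {y₁} {y₂} bc p dom with Biclique.cover bc p
    ... | inj₁ (p~x₁ , _) = y₁≢y₂ (trans (is-p (proj₁ x₁~y)) (sym (is-p (proj₂ x₁~y))))
      where
      open BicliqueSides tf bc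
      is-p : ∀ {y} → x₁ ~ y → y ≡ p
      is-p {y} x₁~y = [ (λ h → h) , (λ y~p → ⊥-elim (tf _ _ _ y~p p~x₁ (~-sym x₁~y))) ]′ (dom y)
    ... | inj₂ (p~y₁ , _) = x₁≢x₂ (trans (is-p (proj₁ x₁~y)) (sym (is-p (proj₁ x₂~y))))
      where
      open BicliqueSides tf bc
      is-p : ∀ {x} → x ~ y₁ → x ≡ p
      is-p {x} x~y₁ = [ (λ h → h) , (λ x~p → ⊥-elim (tf _ _ _ x~p p~y₁ x~y₁)) ]′ (dom x)

    -- Losing the edge leaves `a` with at most one neighbour, which forks exclude from order five
    -- on.
    atMostTwoNeighbours⇒essential : 5 ≤ n → ∀ {a b} → AtMostTwoNeighbours G a → a ~ b → Essential G a b
    atMostTwoNeighbours⇒essential 5≤n {a} {b} (p , q , a≢p , a≢q , only) a~b H H⊆G a≁b with only b a~b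
    ... | inj₁ refl = pendant⇒¬forked {G = H} tfᴴ 5≤n a≢q
            (λ a~t → [ (λ { refl → ⊥-elim (a≁b a~t) }) , (λ h → h) ]′ (only _ (H⊆G a~t)))
      where tfᴴ = λ _ _ _ u~v v~w u~w → tf _ _ _ (H⊆G u~v) (H⊆G v~w) (H⊆G u~w)
    ... | inj₂ refl = pendant⇒¬forked {G = H} tfᴴ 5≤n a≢p
            (λ a~t → [ (λ h → h) , (λ { refl → ⊥-elim (a≁b a~t) }) ]′ (only _ (H⊆G a~t)))
      where tfᴴ = λ _ _ _ u~v v~w u~w → tf _ _ _ (H⊆G u~v) (H⊆G v~w) (H⊆G u~w)

    -- Without x₁ ~ y₁, the only dominating pairs surviving Staller's opening move x₂
    -- are the disjoint pairs {v , u} and {x₁ , y₁}.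
    fullEdge-essential : ∀ {x₁ x₂ y₁ y₂ u v} → Biclique G x₁ x₂ y₁ y₂ →
      u ≢ x₁ → u ≢ x₂ → v ≢ y₁ → v ≢ y₂ →
      (∀ {t} → u ~ t → t ≡ y₁ ⊎ t ≡ y₂) → (∀ {t} → v ~ t → t ≡ x₁ ⊎ t ≡ x₂) → Essential G x₁ y₁
    fullEdge-essential {x₁} {x₂} {y₁} {y₂} {u} {v} bc u≢x₁ u≢x₂ v≢y₁ v≢y₂ N[u] N[v] H H⊆G x₁≁y₁ forked =
      no-fork (pairs centre≢s left≢s dom-left) (pairs centre≢s right≢s dom-right)
      where
      open BicliqueSides tf bc
      open Graph H using () renaming (_~_ to _~ᴴ_; ~-sym to ~ᴴ-sym)
      open Fork (forked x₂)
      x₁≢y₁ = ~⇒≢ G (proj₁ x₁~y)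
      x₁≢y₂ = ~⇒≢ G (proj₂ x₁~y)
      x₂≢y₁ = ~⇒≢ G (proj₁ x₂~y)
      x₂≢y₂ = ~⇒≢ G (proj₂ x₂~y)
      u~y : u ~ y₁ × u ~ y₂
      u~y = [ (λ (u~x₁ , _) → ⊥-elim ([ x₁≢y₁ , x₁≢y₂ ]′ (N[u] u~x₁))) , (λ h → h) ]′ (cover u)
      v~x : v ~ x₁ × v ~ x₂
      v~x = [ (λ h → h) , (λ (v~y₁ , _) → ⊥-elim ([ ≢-sym x₁≢y₁ , ≢-sym x₂≢y₁ ]′ (N[v] v~y₁))) ]′ (cover v)
      u≢v : u ≢ v
      u≢v refl = [ x₁≢y₁ , x₁≢y₂ ]′ (N[u] (proj₁ v~x))
      u≢y₁ = ~⇒≢ G (proj₁ u~y)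
      u≢y₂ = ~⇒≢ G (proj₂ u~y)
      v≢x₁ = ~⇒≢ G (proj₁ v~x)
      x₂≁x₁ : ¬ x₂ ~ x₁
      x₂≁x₁ x₂~x₁ = ~x₁⇒≁y₁ x₂~x₁ (proj₁ x₂~y)
      y₂≁y₁ : ¬ y₂ ~ y₁
      y₂≁y₁ = ~x₁⇒≁y₁ (~-sym (proj₂ x₁~y))
      y₁≁v : ¬ y₁ ~ v
      y₁≁v y₁~v = [ ≢-sym x₁≢y₁ , ≢-sym x₂≢y₁ ]′ (N[v] (~-sym y₁~v))
      y₂≁v : ¬ y₂ ~ v
      y₂≁v y₂~v = [ ≢-sym x₁≢y₂ , ≢-sym x₂≢y₂ ]′ (N[v] (~-sym y₂~v))
      x₂≁u : ¬ x₂ ~ u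
      x₂≁u x₂~u = [ x₂≢y₁ , x₂≢y₂ ]′ (N[u] (~-sym x₂~u))
      undominated : ∀ {p q} t → t ≢ p → ¬ t ~ᴴ p → t ≢ q → ¬ t ~ᴴ q → ¬ DominatingPair H p q
      undominated t t≢p t≁p t≢q t≁q dom = [ [ t≢p , t≁p ]′ , [ t≢q , t≁q ]′ ]′ (dom t)
      -- Staller holds `x₂`, so only `v` and `x₁` can still dominate `v`.
      near-v : ∀ {p} → p ≢ x₂ → Near H p v → p ≡ v ⊎ p ≡ x₁
      near-v p≢x₂ (inj₁ v≡p) = inj₁ (sym v≡p)
      near-v p≢x₂ (inj₂ v~p) = inj₂ ([ (λ h → h) , (λ p≡x₂ → ⊥-elim (p≢x₂ p≡x₂)) ]′ (N[v] (H⊆G v~p)))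
      near-u : ∀ {p} → Near H p u → p ≡ u ⊎ p ≡ y₁ ⊎ p ≡ y₂
      near-u (inj₁ u≡p) = inj₁ (sym u≡p)
      near-u (inj₂ u~p) = inj₂ (N[u] (H⊆G u~p))
      not-both : ∀ {p} → p ≡ v ⊎ p ≡ x₁ → p ≡ u ⊎ p ≡ y₁ ⊎ p ≡ y₂ → ⊥
      not-both (inj₁ refl) = [ ≢-sym u≢v , [ v≢y₁ , v≢y₂ ]′ ]′
      not-both (inj₂ refl) = [ ≢-sym u≢x₁ , [ x₁≢y₁ , x₁≢y₂ ]′ ]′
      oriented : ∀ {p q} → DominatingPair H p q → p ≡ v ⊎ p ≡ x₁ → q ≡ u ⊎ q ≡ y₁ ⊎ q ≡ y₂ →
                 (p ≡ v × q ≡ u) ⊎ (p ≡ x₁ × q ≡ y₁)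
      oriented dom (inj₁ p≡v)  (inj₁ q≡u)         = inj₁ (p≡v , q≡u)
      oriented dom (inj₂ p≡x₁) (inj₂ (inj₁ q≡y₁)) = inj₂ (p≡x₁ , q≡y₁)
      -- Each remaining combination misses a full vertex; only the last one, `{x₁ , y₂}`, fails
      -- because of the missing edge.
      oriented dom (inj₁ refl) (inj₂ (inj₁ refl)) =
        ⊥-elim (undominated y₂ (≢-sym v≢y₂) (y₂≁v ∘ H⊆G) (≢-sym y₁≢y₂) (y₂≁y₁ ∘ H⊆G) dom)
      oriented dom (inj₁ refl) (inj₂ (inj₂ refl)) =
        ⊥-elim (undominated y₁ (≢-sym v≢y₁) (y₁≁v ∘ H⊆G) y₁≢y₂ (y₂≁y₁ ∘ ~-sym ∘ H⊆G) dom)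
      oriented dom (inj₂ refl) (inj₁ refl) =
        ⊥-elim (undominated x₂ (≢-sym x₁≢x₂) (x₂≁x₁ ∘ H⊆G) (≢-sym u≢x₂) (x₂≁u ∘ H⊆G) dom)
      oriented dom (inj₂ refl) (inj₂ (inj₂ refl)) =
        ⊥-elim (undominated y₁ (≢-sym x₁≢y₁) (x₁≁y₁ ∘ ~ᴴ-sym) y₁≢y₂ (y₂≁y₁ ∘ ~-sym ∘ H⊆G) dom)
      Matched : Fin n → Fin n → Set
      Matched p q = ((p ≡ v × q ≡ u) ⊎ (p ≡ x₁ × q ≡ y₁)) ⊎ ((q ≡ v × p ≡ u) ⊎ (q ≡ x₁ × p ≡ y₁))
      pairs : ∀ {p q} → p ≢ x₂ → q ≢ x₂ → DominatingPair H p q → Matched p q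
      pairs p≢x₂ q≢x₂ dom with Sum.map (near-v p≢x₂) (near-v q≢x₂) (dom v) | Sum.map near-u near-u (dom u)
      ... | inj₁ p-v | inj₁ p-u = ⊥-elim (not-both p-v p-u)
      ... | inj₁ p-v | inj₂ q-u = inj₁ (oriented dom p-v q-u)
      ... | inj₂ q-v | inj₁ p-u = inj₂ (oriented (dominatingPair-sym {G = H} dom) q-v p-u)
      ... | inj₂ q-v | inj₂ q-u = ⊥-elim (not-both q-v q-u)
      clash : ∀ {a b c : Fin n} → a ≢ b → c ≡ a → c ≡ b → ⊥
      clash a≢b c≡a c≡b = a≢b (trans (sym c≡a) c≡b)
      -- The vertices `u`, `v`, `x₁`, `y₁` are distinct, so two surviving pairs that share the
      -- centre are equal, and `left` and `right` coincide.
      no-fork : Matched centre left → Matched centre right → ⊥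
      no-fork (inj₁ (inj₁ (_ , l))) (inj₁ (inj₁ (_ , r))) = left≢right (trans l (sym r))
      no-fork (inj₁ (inj₂ (_ , l))) (inj₁ (inj₂ (_ , r))) = left≢right (trans l (sym r))
      no-fork (inj₂ (inj₁ (l , _))) (inj₂ (inj₁ (r , _))) = left≢right (trans l (sym r))
      no-fork (inj₂ (inj₂ (l , _))) (inj₂ (inj₂ (r , _))) = left≢right (trans l (sym r))
      no-fork (inj₁ (inj₁ (c , _))) (inj₁ (inj₂ (c′ , _))) = clash v≢x₁ c c′
      no-fork (inj₁ (inj₁ (c , _))) (inj₂ (inj₁ (_ , c′))) = clash u≢v c′ c
      no-fork (inj₁ (inj₁ (c , _))) (inj₂ (inj₂ (_ , c′))) = clash v≢y₁ c c′
      no-fork (inj₁ (inj₂ (c , _))) (inj₁ (inj₁ (c′ , _))) = clash v≢x₁ c′ c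
      no-fork (inj₁ (inj₂ (c , _))) (inj₂ (inj₁ (_ , c′))) = clash u≢x₁ c′ c
      no-fork (inj₁ (inj₂ (c , _))) (inj₂ (inj₂ (_ , c′))) = clash x₁≢y₁ c c′
      no-fork (inj₂ (inj₁ (_ , c))) (inj₁ (inj₁ (c′ , _))) = clash u≢v c c′
      no-fork (inj₂ (inj₁ (_ , c))) (inj₁ (inj₂ (c′ , _))) = clash u≢x₁ c c′
      no-fork (inj₂ (inj₁ (_ , c))) (inj₂ (inj₂ (_ , c′))) = clash u≢y₁ c c′
      no-fork (inj₂ (inj₂ (_ , c))) (inj₁ (inj₁ (c′ , _))) = clash v≢y₁ c′ c
      no-fork (inj₂ (inj₂ (_ , c))) (inj₁ (inj₂ (c′ , _))) = clash x₁≢y₁ c′ c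
      no-fork (inj₂ (inj₂ (_ , c))) (inj₂ (inj₁ (_ , c′))) = clash u≢y₁ c′ c

-- Criticality of the graphs in `Bipartiteℬ`

module _ {n : ℕ} {G : Graph n} (tf : TriangleFree G) (ℬG : Bipartiteℬ G) where
  open Graph G
  open Bipartiteℬ ℬG renaming (n to n₂)

  private
    module F₁ = TwoElements (twoElements {p = full₁} two-full₁)
    module F₂ = TwoElements (twoElements {p = full₂} two-full₂)
    open F₁ using () renaming (fst to x₁; snd to x₂; fst≢snd to x₁≢x₂)
    open F₂ using () renaming (fst to y₁; snd to y₂; fst≢snd to y₁≢y₂)

    hasDegree : ∀ d t → Dec (degree G t ≡ d)
    hasDegree d t = degree G t ℕ.≟ d

    other-side₁ : ∀ {a b} → a ∈ V₁ → a ~ b → b ∈ V₂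
    other-side₁ a∈ a~b = x∉p⇒x∈∁p (λ b∈ → proj₁ bipartition a∈ b∈ a~b)

    other-side₂ : ∀ {a b} → a ∈ V₂ → a ~ b → b ∈ V₁
    other-side₂ a∈ a~b = x∉∁p⇒x∈p (λ b∈ → proj₂ bipartition a∈ b∈ a~b)

    -- The neighbourhood of `x` is contained in `V₂` and has the same cardinality.
    full-nbrs₁ : ∀ {x y} → x ∈ full₁ → y ∈ V₂ → x ~ y
    full-nbrs₁ {x} x∈ y∈ = ∈⟦⟧⁻ (x ~?_) (⊆∧∣∣≡⇒⊇
      (λ w∈ → other-side₁ (p∩q⊆p _ _ x∈) (∈⟦⟧⁻ (x ~?_) w∈)) (∈⟦⟧⁻ (hasDegree n₂) (p∩q⊆q V₁ _ x∈)) y∈)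

    full-nbrs₂ : ∀ {x y} → y ∈ full₂ → x ∈ V₁ → y ~ x
    full-nbrs₂ {_} {y} y∈ x∈ = ∈⟦⟧⁻ (y ~?_) (⊆∧∣∣≡⇒⊇
      (λ w∈ → other-side₂ (p∩q⊆p _ _ y∈) (∈⟦⟧⁻ (y ~?_) w∈)) (∈⟦⟧⁻ (hasDegree m) (p∩q⊆q V₂ _ y∈)) x∈)

    biclique : Biclique G x₁ x₂ y₁ y₂
    biclique = record { x₁≢x₂ = x₁≢x₂ ; y₁≢y₂ = y₁≢y₂ ; cover = cover }
      where
      cover : ∀ v → (v ~ x₁ × v ~ x₂) ⊎ (v ~ y₁ × v ~ y₂)
      cover v with v ∈? V₁
      ... | yes v∈V₁ = inj₂ (~-sym (full-nbrs₂ F₂.fst∈ v∈V₁) , ~-sym (full-nbrs₂ F₂.snd∈ v∈V₁))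
      ... | no v∉V₁  = inj₁ (~-sym (full-nbrs₁ F₁.fst∈ (x∉p⇒x∈∁p v∉V₁)) , ~-sym (full-nbrs₁ F₁.snd∈ (x∉p⇒x∈∁p v∉V₁)))

    degree2-nbrs : ∀ {t p q} → degree G t ≡ 2 → p ≢ q → t ~ p → t ~ q → ∀ {w} → t ~ w → w ≡ p ⊎ w ≡ q
    degree2-nbrs {t} {p} {q} deg p≢q t~p t~q {w} t~w with w ≟ p | w ≟ q
    ... | yes w≡p | _       = inj₁ w≡p
    ... | no _    | yes w≡q = inj₂ w≡q
    ... | no w≢p  | no w≢q  = ⊥-elim (ℕₚ.<-irrefl (sym deg)
      (length≤∣p∣ {xs = p ∷ q ∷ w ∷ []} ((p≢q ∷ ≢-sym w≢p ∷ []) ∷ (≢-sym w≢q ∷ []) ∷ [] ∷ [])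
        (∈⟦⟧⁺ (t ~?_) t~p ∷ ∈⟦⟧⁺ (t ~?_) t~q ∷ ∈⟦⟧⁺ (t ~?_) t~w ∷ [])))

    nonFull₁-nbrs : ∀ {t} → t ∈ V₁ → t ≢ x₁ → t ≢ x₂ → ∀ {w} → t ~ w → w ≡ y₁ ⊎ w ≡ y₂
    nonFull₁-nbrs {t} t∈ t≢x₁ t≢x₂ = degree2-nbrs
      (others t ([ t≢x₁ , t≢x₂ ]′ ∘ F₁.only) (λ t∈₂ → x∈∁p⇒x∉p (p∩q⊆p V₂ _ t∈₂) t∈))
      y₁≢y₂ (~-sym (full-nbrs₂ F₂.fst∈ t∈)) (~-sym (full-nbrs₂ F₂.snd∈ t∈))

    nonFull₂-nbrs : ∀ {t} → t ∈ V₂ → t ≢ y₁ → t ≢ y₂ → ∀ {w} → t ~ w → w ≡ x₁ ⊎ w ≡ x₂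
    nonFull₂-nbrs {t} t∈ t≢y₁ t≢y₂ = degree2-nbrs
      (others t (λ t∈₁ → x∈∁p⇒x∉p t∈ (p∩q⊆p V₁ _ t∈₁)) ([ t≢y₁ , t≢y₂ ]′ ∘ F₂.only))
      x₁≢x₂ (~-sym (full-nbrs₁ F₁.fst∈ t∈)) (~-sym (full-nbrs₁ F₁.snd∈ t∈))

    5≤n : 5 ≤ n
    5≤n = ℕₚ.≤-trans (ℕₚ.n≤1+n 5) (ℕₚ.≤-trans (ℕₚ.+-mono-≤ m≥3 n≥3)
      (ℕₚ.≤-reflexive (trans (cong (m +_) (∣∁p∣≡n∸∣p∣ V₁)) (ℕₚ.m+[n∸m]≡n (∣p∣≤n V₁)))))

    x∈V₁ : ∀ {x} → x ∈ full₁ → x ∈ V₁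
    x∈V₁ = p∩q⊆p V₁ _

    y∈V₂ : ∀ {y} → y ∈ full₂ → y ∈ V₂
    y∈V₂ = p∩q⊆p V₂ _

    sides-differ : ∀ {a b} → a ∈ V₁ → b ∈ V₂ → a ≢ b
    sides-differ a∈ b∈ refl = x∈∁p⇒x∉p b∈ a∈

    -- The symmetries of the biclique carry `fullEdge-essential` to all four edges; the third
    -- elements of the two sides serve as `u` and `v`.
    fullEdge : ∀ {a b} → a ≡ x₁ ⊎ a ≡ x₂ → b ≡ y₁ ⊎ b ≡ y₂ → Essential G a b
    fullEdge a-full b-full with thirdElement V₁ m≥3 x₁ x₂ | thirdElement V₂ n≥3 y₁ y₂
    ... | u , u∈ , u≢x₁ , u≢x₂ | v , v∈ , v≢y₁ , v≢y₂ with a-full | b-full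
    ... | inj₁ refl | inj₁ refl = fullEdge-essential tf biclique u≢x₁ u≢x₂ v≢y₁ v≢y₂
            (nonFull₁-nbrs u∈ u≢x₁ u≢x₂) (nonFull₂-nbrs v∈ v≢y₁ v≢y₂)
    ... | inj₂ refl | inj₁ refl = fullEdge-essential tf (biclique-swapˡ biclique) u≢x₂ u≢x₁ v≢y₁ v≢y₂
            (nonFull₁-nbrs u∈ u≢x₁ u≢x₂) (Sum.swap ∘ nonFull₂-nbrs v∈ v≢y₁ v≢y₂)
    ... | inj₁ refl | inj₂ refl = fullEdge-essential tf (biclique-swapʳ biclique) u≢x₁ u≢x₂ v≢y₂ v≢y₁
            (Sum.swap ∘ nonFull₁-nbrs u∈ u≢x₁ u≢x₂) (nonFull₂-nbrs v∈ v≢y₁ v≢y₂)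
    ... | inj₂ refl | inj₂ refl = fullEdge-essential tf (biclique-swapˡ (biclique-swapʳ biclique)) u≢x₂ u≢x₁ v≢y₂ v≢y₁
            (Sum.swap ∘ nonFull₁-nbrs u∈ u≢x₁ u≢x₂) (Sum.swap ∘ nonFull₂-nbrs v∈ v≢y₁ v≢y₂)

    edge-essential : ∀ {a b} → a ∈ V₁ → b ∈ V₂ → a ~ b → Essential G a b
    edge-essential {a} {b} a∈ b∈ a~b with (a ≟ x₁) ⊎-dec (a ≟ x₂) | (b ≟ y₁) ⊎-dec (b ≟ y₂)
    ... | yes a-full | yes b-full = fullEdge a-full b-full
    ... | no ¬a-full | _ = atMostTwoNeighbours⇒essential {G = G} tf 5≤n
            ( y₁ , y₂ , sides-differ a∈ (y∈V₂ F₂.fst∈) , sides-differ a∈ (y∈V₂ F₂.snd∈)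
            , λ _ → nonFull₁-nbrs a∈ (¬a-full ∘ inj₁) (¬a-full ∘ inj₂)) a~b
    ... | yes _ | no ¬b-full = essential-sym {G = G} (atMostTwoNeighbours⇒essential {G = G} tf 5≤n
            ( x₁ , x₂ , ≢-sym (sides-differ (x∈V₁ F₁.fst∈) b∈) , ≢-sym (sides-differ (x∈V₁ F₁.snd∈) b∈)
            , λ _ → nonFull₂-nbrs b∈ (¬b-full ∘ inj₁) (¬b-full ∘ inj₂)) (~-sym a~b))

  bipartiteℬ⇒critical : Critical 2 G
  bipartiteℬ⇒critical = essential⇒critical x₁ (biclique⇒forked biclique) (biclique⇒¬dominatingVertex tf biclique) essential
    where
    essential : ∀ {a b} → a ~ b → Essential G a b
    essential {a} a~b with a ∈? V₁
    ... | yes a∈ = edge-essential a∈ (other-side₁ a∈ a~b) a~b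
    ... | no a∉  = essential-sym {G = G} (edge-essential (other-side₂ (x∉p⇒x∈∁p a∉) a~b) (x∉p⇒x∈∁p a∉) (~-sym a~b))

-- Transport along isomorphisms

module _ {n k : ℕ} {G : Graph n} {H : Graph k} (iso : G ≅ H) where
  open _≅_ iso
  open Inverse bijection using (strictlyInverseˡ; strictlyInverseʳ)
  private
    module G = Graph G
    module H = Graph H

  to~⇒~from : ∀ {v i} → to v H.~ i → v G.~ from i
  to~⇒~from {v} {i} e = Equivalence.from (preserves v (from i)) (subst (to v H.~_) (sym (strictlyInverseˡ i)) e)

  ~⇒to~to : ∀ {u v} → u G.~ v → to u H.~ to v
  ~⇒to~to {u} {v} = Equivalence.to (preserves u v)

  to≡⇒≡from : ∀ {v i} → to v ≡ i → v ≡ from i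
  to≡⇒≡from {v} refl = sym (strictlyInverseʳ v)

  ≡from⇒to≡ : ∀ {v i} → v ≡ from i → to v ≡ i
  ≡from⇒to≡ {i = i} refl = strictlyInverseˡ i

  from-injective : ∀ {i j} → from i ≡ from j → i ≡ j
  from-injective {i} {j} eq = trans (sym (strictlyInverseˡ i)) (≡from⇒to≡ eq)

  dominatingPair-from : ∀ {x y} → DominatingPair H x y → DominatingPair G (from x) (from y)
  dominatingPair-from dom v = Sum.map (Sum.map to≡⇒≡from to~⇒~from) (Sum.map to≡⇒≡from to~⇒~from) (dom (to v))

  forked-≅ : Forked H → Forked G
  forked-≅ forked s = record
    { centre = from centre ; left = from left ; right = from right
    ; centre≢s = centre≢s ∘ sym ∘ ≡from⇒to≡ ∘ sym
    ; left≢s = left≢s ∘ sym ∘ ≡from⇒to≡ ∘ sym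
    ; right≢s = right≢s ∘ sym ∘ ≡from⇒to≡ ∘ sym
    ; left≢centre = left≢centre ∘ from-injective
    ; right≢centre = right≢centre ∘ from-injective
    ; left≢right = left≢right ∘ from-injective
    ; dom-left = dominatingPair-from dom-left ; dom-right = dominatingPair-from dom-right }
    where open Fork (forked (to s))

  dominatingVertex-to : ∀ {p} → DominatingVertex G p → DominatingVertex H (to p)
  dominatingVertex-to {p} dom i with dom (from i)
  ... | inj₁ eq = inj₁ (sym (≡from⇒to≡ (sym eq)))
  ... | inj₂ e  = inj₂ (subst (H._~ to p) (strictlyInverseˡ i) (~⇒to~to e))

  atMostTwoNeighbours-≅ : ∀ {v} → AtMostTwoNeighbours H (to v) → AtMostTwoNeighbours G v
  atMostTwoNeighbours-≅ (p , q , v≢p , v≢q , only) =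
    from p , from q , v≢p ∘ ≡from⇒to≡ , v≢q ∘ ≡from⇒to≡ ,
    λ t v~t → Sum.map to≡⇒≡from to≡⇒≡from (only (to t) (~⇒to~to v~t))

-- Criticality of `K 2 m` and of `C₅`

K₂ₘ⇒critical : ∀ {n m} {G : Graph n} → TriangleFree G → 3 ≤ m → G ≅ K 2 m → Critical 2 G
-- Matching on the bound exposes successors in `m`, so that 2 and 3 are literal vertices of `K 2 m`.
K₂ₘ⇒critical {n} {m} {G} tf 3≤m@(s≤s (s≤s (s≤s _))) iso =
  essential⇒critical (from zero) (biclique⇒forked biclique) (biclique⇒¬dominatingVertex tf biclique) essential
  where
  open Graph G
  open _≅_ iso
  2≤2+ : ∀ {k} → 2 ≤ suc (suc k)
  2≤2+ = s≤s (s≤s z≤n)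
  1<2 : 1 < 2
  1<2 = s≤s (s≤s z≤n)
  biclique : Biclique G (from zero) (from (suc zero)) (from (suc (suc zero))) (from (suc (suc (suc zero))))
  biclique = record
    { x₁≢x₂ = (λ ()) ∘ from-injective iso ; y₁≢y₂ = (λ ()) ∘ from-injective iso ; cover = cover }
    where
    cover : ∀ v → _
    cover v with toℕ (to v) ℕ.<? 2
    ... | yes v<2 = inj₂ (to~⇒~from iso (inj₁ (v<2 , 2≤2+)) , to~⇒~from iso (inj₁ (v<2 , 2≤2+)))
    ... | no v≮2  = inj₁ ( to~⇒~from iso (inj₂ (ℕₚ.≮⇒≥ v≮2 , s≤s z≤n)) , to~⇒~from iso (inj₂ (ℕₚ.≮⇒≥ v≮2 , 1<2)))
  few : ∀ i → 2 ≤ toℕ i → AtMostTwoNeighbours (K 2 m) i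
  few i 2≤i = zero , suc zero , (λ { refl → ℕₚ.<⇒≱ (s≤s z≤n) 2≤i }) , (λ { refl → ℕₚ.<⇒≱ 1<2 2≤i }) , only
    where
    only : ∀ t → Graph._~_ (K 2 m) i t → t ≡ zero ⊎ t ≡ suc zero
    only t             (inj₁ (i<2 , _)) = ⊥-elim (ℕₚ.<⇒≱ i<2 2≤i)
    only zero          (inj₂ _)         = inj₁ refl
    only (suc zero)    (inj₂ _)         = inj₂ refl
    only (suc (suc _)) (inj₂ (_ , s≤s (s≤s ())))
  5≤n : 5 ≤ n
  5≤n = subst (5 ≤_) (sym (↔⇒≡ bijection)) (s≤s (s≤s 3≤m))
  essential : ∀ {a b} → a ~ b → Essential G a b
  -- Every edge has an end on the side of size `m`, whose vertices have just two neighbours.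
  essential a~b with ~⇒to~to iso a~b
  ... | inj₁ (_ , 2≤b) = essential-sym {G = G}
          (atMostTwoNeighbours⇒essential {G = G} tf 5≤n (atMostTwoNeighbours-≅ iso (few _ 2≤b)) (~-sym a~b))
  ... | inj₂ (2≤a , _) = atMostTwoNeighbours⇒essential {G = G} tf 5≤n (atMostTwoNeighbours-≅ iso (few _ 2≤a)) a~b

module _ where
  open Graph C₅

  near₅? : ∀ x v → Dec (Near C₅ x v)
  near₅? x v = (v ≟ x) ⊎-dec (v ~? x)

  dominatingPair₅? : ∀ x y → Dec (DominatingPair C₅ x y)
  dominatingPair₅? x y = all? λ v → near₅? x v ⊎-dec near₅? y v

  -- The dominating pairs of `C₅` are its non-adjacent pairs, so the answer to `s` is its
  -- predecessor, paired with the two successors of `s`.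
  C₅-forked : Forked C₅
  C₅-forked = λ where
      0F → fork 4F 2F 1F
      1F → fork 0F 3F 2F
      2F → fork 1F 4F 3F
      3F → fork 2F 0F 4F
      4F → fork 3F 1F 0F
    where
    -- The side conditions are decidable, and the implicit `True` arguments are filled by
    -- evaluation.
    fork : ∀ {s} d e f {d≢s : True (¬? (d ≟ s))} {e≢s : True (¬? (e ≟ s))} {f≢s : True (¬? (f ≟ s))}
           {e≢d : True (¬? (e ≟ d))} {f≢d : True (¬? (f ≟ d))} {e≢f : True (¬? (e ≟ f))}
           {de : True (dominatingPair₅? d e)} {df : True (dominatingPair₅? d f)} → Fork C₅ s
    fork d e f {d≢s} {e≢s} {f≢s} {e≢d} {f≢d} {e≢f} {de} {df} = record
      { centre = d ; left = e ; right = f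
      ; centre≢s = toWitness d≢s ; left≢s = toWitness e≢s ; right≢s = toWitness f≢s
      ; left≢centre = toWitness e≢d ; right≢centre = toWitness f≢d ; left≢right = toWitness e≢f
      ; dom-left = toWitness de ; dom-right = toWitness df }

  C₅-¬dominatingVertex : ∀ p → ¬ DominatingVertex C₅ p
  C₅-¬dominatingVertex = from-yes (all? λ p → ¬? (all? (near₅? p)))

  C₅-atMostTwoNeighbours : ∀ v → AtMostTwoNeighbours C₅ v
  C₅-atMostTwoNeighbours = from-yes (all? λ v → any? λ p → any? λ q →
    ¬? (v ≟ p) ×-dec ¬? (v ≟ q) ×-dec all? (λ t → (v ~? t) →-dec ((t ≟ p) ⊎-dec (t ≟ q))))

C₅⇒critical : ∀ {n} {G : Graph n} → TriangleFree G → G ≅ C₅ → Critical 2 G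
C₅⇒critical {G = G} tf iso = essential⇒critical (_≅_.from iso zero) (forked-≅ iso C₅-forked)
  (λ _ dom → C₅-¬dominatingVertex _ (dominatingVertex-to iso dom))
  (atMostTwoNeighbours⇒essential {G = G} tf (ℕₚ.≤-reflexive (sym (↔⇒≡ (_≅_.bijection iso))))
    (atMostTwoNeighbours-≅ iso (C₅-atMostTwoNeighbours _)))

theorem2p6 : ∀ {n : ℕ} (G : Graph n) → Connected G → TriangleFree G →
    Critical 2 G ⇔ (ℬ G ⊎ G ≅ C₅)
theorem2p6 G conn tf = mk⇔ (critical⇒ℬ-or-C₅ tf conn)
  [ [ (λ (_ , 3≤m , iso) → K₂ₘ⇒critical tf 3≤m iso) , bipartiteℬ⇒critical tf ]′ , C₅⇒critical tf ]′
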